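{- Let $C$ be a set of untranslated join-irreducible permutations (of various sizes). A permutation $x\in S_n$ is contracted by $\mathcal{H}(C)_n$ if and only if for some $\gamma\in C$ there is a scramble $\sigma$ of $\gamma$ which occurs in $x$ with adjacent cliff.
   Context: $S_n$: permutations of $[n]$ in one-line notation $x_1\cdots x_n$ with the right weak order ($x\le y$ iff the set of inverted value pairs of $x$ is contained in that of $y$; covers swap adjacent entries to create an inversion), a lattice. A join-irreducible of $S_n$ is a permutation with exactly one descent $x_i>x_{i+1}$; it covers exactly one element $\gamma_*$. Its associated subset is $A=\{\gamma_{i+1},\dots,\gamma_n\}$ (where $i$ is the descent), $m=\min A$, $M=\max([n]\setminus A)$; $\gamma$ is the elements of $[n]\setminus A$ increasing followed by those of $A$ increasing. For $u\in S_p,v\in S_q$, $u\times v=u_1\cdots u_p(p+v_1)\cdots(p+v_q)$; $1_k$ is the identity of $S_k$. A permutation $x\in S_n$ is untranslated if $x_1>1$ and $x_n<n$; an untranslated join-irreducible $\gamma\in S_k$ has $\gamma_j=k$, $\gamma_{j+1}=1$ at its descent $j$. For such $\gamma$, a scramble is any $\sigma\in S_k$ with $\sigma_j=k$, $\sigma_{j+1}=1$ and $\{\sigma_1,..,\sigma_{j-1}\}=\{\gamma_1,..,\gamma_{j-1}\}$. A permutation $y\in S_k$ with $y_j=k,y_{j+1}=1$ occurs in $x\in S_n$ with adjacent cliff if there are $i_1<\dots<i_k$ with $x_{i_p}<x_{i_q}\iff y_p<y_q$ for all $p,q$, and $i_{j+1}=i_j+1$. A congruence $\Theta$ on $S_n$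 contracts $x$ if $x\equiv y$ for some $y$ covered by $x$; it contracts a join-irreducible $\gamma$ if $\gamma\equiv\gamma_*$. $\mathrm{st}(a_1..a_k)$ is the $u\in S_k$ with $u_i<u_j\iff a_i<a_j$. A family $\{\Theta_n\}_{n\ge0}$ of congruences on $S_n$ is translational if $u\times v\equiv u'\times v'$ mod $\Theta_{p+q}$ iff $u\equiv u'$ mod $\Theta_p$ and $v\equiv v'$ mod $\Theta_q$; insertional if for every $p$-subset $Q\subseteq[p+q]$, with $\varphi_Q(u,v)$ the unique $x\in S_{p+q}$ with $\{x_1..x_p\}=Q$, $\mathrm{st}(x_1..x_p)=u$, $\mathrm{st}(x_{p+1}..x_{p+q})=v$, we have $u\equiv u',v\equiv v'\Rightarrow\varphi_Q(u,v)\equiv\varphi_Q(u',v')$; an $\mathcal{H}$-family if both. $\{\mathcal{H}(C)_n\}_{n\ge0}$ is the smallest $\mathcal{H}$-family contracting every element of $C$. -}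

module Defs where

open import Level using (0ℓ)
open import Data.Nat.Base as ℕ using (ℕ; zero; suc)
open import Data.Fin.Base using (Fin; zero; suc; toℕ; fromℕ; _<_; _↑ˡ_; _↑ʳ_)
open import Data.Fin.Properties using (+↔⊎)
open import Data.Fin.Permutation using (Permutation′; _⟨$⟩ʳ_; _⟨$⟩ˡ_)
open import Data.Fin.Subset using (Subset; _∈_; ∣_∣)
open import Data.Sum.Base using (_⊎_)
open import Data.Sum.Function.Propositional using (_⊎-↔_)
open import Data.Product.Base using (_×_; ∃; ∃₂)
open import Data.Product using (∃!)
open import Data.Empty using (⊥)
open import Function.Bundles using (_⇔_)
open import Function.Construct.Composition using (_↔-∘_)
open import Function.Construct.Symmetry using (↔-sym)
open import Relation.Nullary using (¬_)
open import Relation.Unary using (Pred)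
open import Relation.Binary.Core using (Rel; _Preserves_⟶_)
open import Relation.Binary.Structures using (IsEquivalence)
open import Relation.Binary.PropositionalEquality.Core using (_≡_)

private variable
  k m n p q : ℕ

-- Positions and values are numbered from 0, so [n] is Fin n.  The entry of x
-- at position i is  x ⟨$⟩ʳ i , and the position of the value a is  x ⟨$⟩ˡ a .
Perm : ℕ → Set
Perm = Permutation′

------------------------------------------------------------------------
-- The weak order

Inverted : Perm n → Rel (Fin n) 0ℓ
Inverted x a b = a < b × x ⟨$⟩ˡ b < x ⟨$⟩ˡ a

infix 4 _≤_ _⋖_

_≤_ : Rel (Perm n) 0ℓ
x ≤ y = ∀ {a b} → Inverted x a b → Inverted y a b

-- y ⋖ x : y is covered by x.
_⋖_ : Rel (Perm n) 0ℓ
y ⋖ x = y ≤ x × ¬ (x ≤ y) × (∀ z → y ≤ z → z ≤ x → z ≤ y ⊎ x ≤ z)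

record IsJoin (x y z : Perm n) : Set where
  field
    left  : x ≤ z
    right : y ≤ z
    least : ∀ w → x ≤ w → y ≤ w → z ≤ w

record IsMeet (x y z : Perm n) : Set where
  field
    left     : z ≤ x
    right    : z ≤ y
    greatest : ∀ w → w ≤ x → w ≤ y → w ≤ z

-- Joins and meets are determined only up to pointwise equality of
-- permutations.  Since x and any pointwise equal x′ are both joins of x with
-- itself, join-cong and reflexivity identify pointwise equal permutations.
record IsCongruence (Θ : Rel (Perm n) 0ℓ) : Set where
  field
    isEquivalence : IsEquivalence Θ
    join-cong : ∀ {x x′ y y′ z z′} → Θ x x′ → Θ y y′ →
                IsJoin x y z → IsJoin x′ y′ z′ → Θ z z′
    meet-cong : ∀ {x x′ y y′ z z′} → Θ x x′ → Θ y y′ →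
                IsMeet x y z → IsMeet x′ y′ z′ → Θ z z′

Contracts : Rel (Perm n) 0ℓ → Pred (Perm n) 0ℓ
Contracts Θ x = ∃ λ y → y ⋖ x × Θ x y

------------------------------------------------------------------------
-- Join-irreducibles

Adjacent : Rel (Fin n) 0ℓ
Adjacent i i′ = toℕ i′ ≡ suc (toℕ i)

Descent : Perm n → Rel (Fin n) 0ℓ
Descent x i i′ = Adjacent i i′ × x ⟨$⟩ʳ i′ < x ⟨$⟩ʳ i

JoinIrreducible : Pred (Perm n) 0ℓ
JoinIrreducible x = ∃! _≡_ λ i → ∃ λ i′ → Descent x i i′

-- The empty permutation has no first and last entry; it is not a
-- join-irreducible either, so its treatment here is immaterial.
Untranslated : Pred (Perm n) 0ℓ
Untranslated {zero}  x = ⊥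
Untranslated {suc n} x = zero {n} < x ⟨$⟩ʳ zero × x ⟨$⟩ʳ fromℕ n < fromℕ n

------------------------------------------------------------------------
-- Families of congruences

infixr 5 _⊗_

-- The permutation u × v = u₁ ⋯ u_p (p + v₁) ⋯ (p + v_q).
_⊗_ : Perm p → Perm q → Perm (p ℕ.+ q)
u ⊗ v = ↔-sym +↔⊎ ↔-∘ ((u ⊎-↔ v) ↔-∘ +↔⊎)

-- u is the standardization of the word a₁ ⋯ a_k.
IsStd : (Fin k → Fin n) → Perm k → Set
IsStd a u = ∀ i j → (u ⟨$⟩ʳ i < u ⟨$⟩ʳ j) ⇔ (a i < a j)

-- x = φ_Q(u,v).
record IsInsertion (Q : Subset (p ℕ.+ q)) (u : Perm p) (v : Perm q)
                   (x : Perm (p ℕ.+ q)) : Set where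
  field
    prefix-set : ∀ a → a ∈ Q ⇔ (∃ λ (i : Fin p) → x ⟨$⟩ʳ (i ↑ˡ q) ≡ a)
    prefix-std : IsStd (λ i → x ⟨$⟩ʳ (i ↑ˡ q)) u
    suffix-std : IsStd (λ j → x ⟨$⟩ʳ (p ↑ʳ j)) v

Family : Set₁
Family = ∀ n → Rel (Perm n) 0ℓ

Translational : Family → Set
Translational Θ = ∀ {p q} (u u′ : Perm p) (v v′ : Perm q) →
  Θ (p ℕ.+ q) (u ⊗ v) (u′ ⊗ v′) ⇔ (Θ p u u′ × Θ q v v′)

Insertional : Family → Set
Insertional Θ = ∀ {p q} (Q : Subset (p ℕ.+ q)) → ∣ Q ∣ ≡ p →
  ∀ {u u′ : Perm p} {v v′ : Perm q} {x x′} →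
  IsInsertion Q u v x → IsInsertion Q u′ v′ x′ →
  Θ p u u′ → Θ q v v′ → Θ (p ℕ.+ q) x x′

record IsHFamily (Θ : Family) : Set where
  field
    isCongruence  : ∀ n → IsCongruence (Θ n)
    translational : Translational Θ
    insertional   : Insertional Θ

PermSet : Set₁
PermSet = ∀ k → Pred (Perm k) 0ℓ

ContractsAll : PermSet → Family → Set
ContractsAll C Θ = ∀ {k} (γ : Perm k) → C k γ → Contracts (Θ k) γ

-- H is the family 𝓗(C).
record IsSmallestHFamily (C : PermSet) (H : Family) : Set₁ where
  field
    isHFamily : IsHFamily H
    contracts : ContractsAll C H
    smallest  : ∀ Θ → IsHFamily Θ → ContractsAll C Θ →
                ∀ {n} {x y : Perm n} → H n x y → Θ n x y

------------------------------------------------------------------------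
-- Scrambles and pattern occurrence

-- σ has its largest possible value at position j, immediately followed by its
-- smallest possible value at position j′.
Cliff : Perm k → Rel (Fin k) 0ℓ
Cliff {k} σ j j′ =
  Adjacent j j′ × suc (toℕ (σ ⟨$⟩ʳ j)) ≡ k × toℕ (σ ⟨$⟩ʳ j′) ≡ 0

EntryBefore : Perm k → Fin k → Pred (Fin k) 0ℓ
EntryBefore x j a = ∃ λ i → i < j × x ⟨$⟩ʳ i ≡ a

Scramble : Perm k → Pred (Perm k) 0ℓ
Scramble γ σ = ∃₂ λ j j′ → Descent γ j j′ × Cliff σ j j′ ×
  (∀ a → EntryBefore σ j a ⇔ EntryBefore γ j a)

OccursWithAdjacentCliff : Perm k → Perm n → Set
OccursWithAdjacentCliff {k} {n} y x =
  ∃₂ λ j j′ → Cliff y j j′ ×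
  ∃ λ (ι : Fin k → Fin n) →
    ι Preserves _<_ ⟶ _<_ ×
    (∀ s t → (x ⟨$⟩ʳ ι s < x ⟨$⟩ʳ ι t) ⇔ (y ⟨$⟩ʳ s < y ⟨$⟩ʳ t)) ×
    Adjacent (ι j) (ι j′)

-- An edge of the weak order swaps two adjacent entries b a, a < b, and up to
-- forcing it is determined by its arc: a, b and the word recording which values
-- between a and b lie left or right of the cliff.  Call an arc contracted if its
-- word contains the word of some γ in C as a (scattered) subword, and let x ≡ y if
-- the join-irreducibles of the uncontracted arcs below x and below y agree.  This
-- respects meets at once, and joins because the dual condition on
-- meet-irreducibles is equivalent: a minimal violation of one is a subarc that
-- violates the other.  The resulting family is an 𝓗-family contracting C, so 𝓗(C)
-- contracts no more than it does.  Conversely, every 𝓗-family contracting C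
-- contracts an edge whose word contains that of γ: removing one by one the values
-- outside the pattern leaves a scramble of γ, and each value can be put back by an
-- insertion at the front or at the end, which does not change the arc of the edge.

module Submission where

open import Defs
open import Level using (0ℓ)
open import Data.Bool.Base using (Bool; true; false; not)
open import Data.Nat.Base as ℕ using (ℕ; zero; suc; z≤n; s≤s)
import Data.Bool.Properties as Boolₚ
import Data.Nat.Properties as ℕₚ
open import Data.Fin.Base as Fin
  using (Fin; zero; suc; toℕ; fromℕ; fromℕ<; opposite; punchIn; punchOut; _<_; _↑ˡ_; _↑ʳ_)
import Data.Fin.Properties as Finₚ
open import Data.Fin.Permutation
  using (_⟨$⟩ʳ_; _⟨$⟩ˡ_; inverseˡ; inverseʳ; insert; insert-punchIn; id; reverse; _∘ₚ_)
import Data.Fin.Subset.Properties as Subsetₚ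
open import Data.Fin.Subset using (Subset; _∈_; ⁅_⁆; ∁)
open import Data.Product.Base using (_×_; _,_; ∃; ∃₂; proj₁; proj₂)
open import Data.Sum.Base as Sum using (_⊎_; inj₁; inj₂)
open import Function.Base using (_∘_)
open import Function.Bundles using (_⇔_; mk⇔; Equivalence)
open import Function.Definitions using (Injective)
open import Relation.Nullary using (does; ¬_; Dec; yes; no; contradiction; _×-dec_; _⊎-dec_)
open import Relation.Unary using (Pred; Decidable)
open import Relation.Binary.Core using (Rel; _Preserves_⟶_)
open import Relation.Binary.Definitions using (tri<; tri≈; tri>)
open import Relation.Binary.Structures using (IsEquivalence)
open import Relation.Binary.PropositionalEquality
  using (_≡_; _≢_; refl; sym; trans; cong; subst; subst₂; ≢-sym; module ≡-Reasoning)

-- An arc does not mention the values outside [a,b], and contraction depends only on subwords of its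
-- word. This makes the arcs fit the two axioms: a translation leaves the word unchanged, and an
-- insertion can only lengthen it. The set `C` is an arbitrary predicate, so no procedure decides
-- whether an arc is contracted. "Each uncontracted arc" therefore becomes a disjunction, whose
-- second half is a match met on the way, and such a match has to escape from finite quantifiers.
-- Permutations are compared only through the relative positions of values, and new ones arise by
-- sorting the values by a numerical key. A cover relation does not tell which two values it swaps;
-- both implications have to recover them before arcs apply.

private variable
  k m n p q : ℕ

-- Increasing maps

Increasing : (Fin m → Fin n) → Set
Increasing f = f Preserves _<_ ⟶ _<_

≮∧≢⇒> : {i j : Fin n} → ¬ (i < j) → i ≢ j → j < i
≮∧≢⇒> {i = i} {j} i≮j i≢j with Finₚ.<-cmp i j
... | tri< i<j _ _ = contradiction i<j i≮j
... | tri≈ _ i≡j _ = contradiction i≡j i≢j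
... | tri> _ _ j<i = j<i

≤⇒<∨≡ : {i j : Fin n} → i Fin.≤ j → i < j ⊎ i ≡ j
≤⇒<∨≡ i≤j = Sum.map₂ Finₚ.toℕ-injective (ℕₚ.m≤n⇒m<n∨m≡n i≤j)

module _ {f : Fin m → Fin n} (f↑ : Increasing f) where

  increasing-cancel : ∀ {i j} → f i < f j → i < j
  increasing-cancel {i} {j} fi<fj with Finₚ.<-cmp i j
  ... | tri< i<j _ _  = i<j
  ... | tri≈ _ refl _ = contradiction fi<fj (ℕₚ.<-irrefl refl)
  ... | tri> _ _ j<i  = contradiction (f↑ j<i) (ℕₚ.<-asym fi<fj)

  increasing-injective : ∀ {i j} → f i ≡ f j → i ≡ j
  increasing-injective {i} {j} fi≡fj with Finₚ.<-cmp i j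
  ... | tri< i<j _ _ = contradiction (f↑ i<j) (ℕₚ.<-irrefl (cong toℕ fi≡fj))
  ... | tri≈ _ i≡j _ = i≡j
  ... | tri> _ _ j<i = contradiction (f↑ j<i) (ℕₚ.<-irrefl (cong toℕ (sym fi≡fj)))

  increasing-≤ : ∀ {i j} → i Fin.≤ j → f i Fin.≤ f j
  increasing-≤ i≤j with ≤⇒<∨≡ i≤j
  ... | inj₁ i<j  = ℕₚ.<⇒≤ (f↑ i<j)
  ... | inj₂ refl = ℕₚ.≤-refl

  increasing-cancel-≤ : ∀ {i j} → f i Fin.≤ f j → i Fin.≤ j
  increasing-cancel-≤ fi≤fj with ≤⇒<∨≡ fi≤fj
  ... | inj₁ fi<fj = ℕₚ.<⇒≤ (increasing-cancel fi<fj)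
  ... | inj₂ fi≡fj = ℕₚ.≤-reflexive (cong toℕ (increasing-injective fi≡fj))

increasing-lower : {f : Fin m → Fin n} → Increasing f → ∀ i → toℕ i ℕ.≤ toℕ (f i)
increasing-lower f↑ zero    = z≤n
increasing-lower f↑ (suc i) = ℕₚ.<-≤-trans
  (s≤s (increasing-lower (f↑ ∘ subst₂ ℕ._<_ (sym (Finₚ.toℕ-inject₁ _)) (sym (Finₚ.toℕ-inject₁ _))) i))
  (f↑ (s≤s (ℕₚ.≤-reflexive (Finₚ.toℕ-inject₁ i))))

-- The `m - 1 - i` arguments above `i` need as many values above `f i`. Sums are used because
-- subtraction truncates. For `m = n` this is the converse bound to `increasing-lower`.
increasing-upper : {f : Fin m → Fin n} → Increasing f → ∀ i → m ℕ.+ toℕ (f i) ℕ.≤ n ℕ.+ toℕ i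
increasing-upper {suc zero} {n} {f} f↑ zero =
  subst (suc (toℕ (f zero)) ℕ.≤_) (sym (ℕₚ.+-identityʳ n)) (Finₚ.toℕ<n (f zero))
increasing-upper {suc (suc m)} {n} {f} f↑ zero = ℕₚ.≤-trans
  (subst (ℕ._≤ suc m ℕ.+ toℕ (f (suc zero))) (cong suc (ℕₚ.+-suc m (toℕ (f zero))))
    (ℕₚ.+-monoʳ-≤ (suc m) (f↑ {zero} {suc zero} (s≤s z≤n))))
  (increasing-upper (f↑ ∘ s≤s) zero)
increasing-upper {suc m} {n} {f} f↑ (suc i) =
  subst (suc m ℕ.+ toℕ (f (suc i)) ℕ.≤_) (sym (ℕₚ.+-suc n (toℕ i))) (s≤s (increasing-upper (f↑ ∘ s≤s) i))

increasing-id : {f : Fin n → Fin n} → Increasing f → ∀ i → f i ≡ i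
increasing-id {n} f↑ i = Finₚ.toℕ-injective (ℕₚ.≤-antisym
  (ℕₚ.+-cancelˡ-≤ n _ _ (increasing-upper f↑ i)) (increasing-lower f↑ i))

-- The window from `l` to `u` lets the lemma serve the increasing run on either side of a descent;
-- the induction is on the distance of `i` and `j`.
steps⇒increasing : {f : Fin m → Fin n} (l u : ℕ) →
  (∀ {i i′} → Adjacent i i′ → l ℕ.≤ toℕ i → toℕ i′ ℕ.≤ u → f i < f i′) →
  ∀ {i j} → i < j → l ℕ.≤ toℕ i → toℕ j ℕ.≤ u → f i < f j
steps⇒increasing {m} {f = f} l u step {i} {j} i<j l≤i = go (toℕ j ℕ.∸ suc (toℕ i)) (sym (ℕₚ.m∸n+n≡m i<j))
  where
  go : ∀ d {j} → toℕ j ≡ d ℕ.+ suc (toℕ i) → toℕ j ℕ.≤ u → f i < f j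
  go zero    j≡ j≤u = step j≡ l≤i j≤u
  go (suc d) {j} j≡ j≤u = ℕₚ.<-trans (go d h≡ (ℕₚ.≤-trans (ℕₚ.<⇒≤ h<j) j≤u)) (step adj l≤h j≤u)
    where
    h<m : d ℕ.+ suc (toℕ i) ℕ.< m
    h<m = ℕₚ.<-trans (ℕₚ.≤-reflexive (sym j≡)) (Finₚ.toℕ<n j)
    h = fromℕ< h<m
    h≡ : toℕ h ≡ d ℕ.+ suc (toℕ i)
    h≡ = Finₚ.toℕ-fromℕ< h<m
    adj : toℕ j ≡ suc (toℕ h)
    adj = trans j≡ (cong suc (sym h≡))
    h<j : h < j
    h<j = ℕₚ.≤-reflexive (sym adj)
    l≤h : l ℕ.≤ toℕ h
    l≤h = ℕₚ.≤-trans l≤i (ℕₚ.≤-trans (ℕₚ.n≤1+n _) (subst (suc (toℕ i) ℕ.≤_) (sym h≡) (ℕₚ.m≤n+m _ d)))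

adjacent⇒< : {i i′ : Fin n} → Adjacent i i′ → i < i′
adjacent⇒< adj = ℕₚ.≤-reflexive (sym adj)

adjacent⇒empty : {i i′ l : Fin n} → Adjacent i i′ → i < l → ¬ (l < i′)
adjacent⇒empty adj i<l l<i′ = ℕₚ.<⇒≱ i<l (ℕₚ.≤-pred (subst (_ ℕ.<_) adj l<i′))

empty⇒adjacent : {i i′ : Fin n} → i < i′ → (∀ l → i < l → ¬ (l < i′)) → Adjacent i i′
empty⇒adjacent {n} {i} {i′} i<i′ empty with ℕₚ.m≤n⇒m<n∨m≡n i<i′
... | inj₂ eq = sym eq
... | inj₁ 1+i<i′ = contradiction (subst (ℕ._< toℕ i′) (sym l≡) 1+i<i′)
                      (empty (fromℕ< l<n) (ℕₚ.≤-reflexive (sym l≡)))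
  where
  l<n : suc (toℕ i) ℕ.< n
  l<n = ℕₚ.<-trans 1+i<i′ (Finₚ.toℕ<n i′)
  l≡ : toℕ (fromℕ< l<n) ≡ suc (toℕ i)
  l≡ = Finₚ.toℕ-fromℕ< l<n

-- Constructing permutations from sorting keys

pos : Perm n → Fin n → Fin n
pos x a = x ⟨$⟩ˡ a

pos-injective : (x : Perm n) → ∀ {a b} → pos x a ≡ pos x b → a ≡ b
pos-injective x eq = trans (sym (inverseʳ x)) (trans (cong (x ⟨$⟩ʳ_) eq) (inverseʳ x))

pos-connex : (x : Perm n) → ∀ {a b} → a ≢ b → pos x a < pos x b ⊎ pos x b < pos x a
pos-connex x {a} {b} a≢b with Finₚ.<-cmp (pos x a) (pos x b)
... | tri< lt _ _ = inj₁ lt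
... | tri≈ _ eq _ = contradiction (pos-injective x eq) a≢b
... | tri> _ _ gt = inj₂ gt

value-injective : (x : Perm n) → ∀ {i j} → x ⟨$⟩ʳ i ≡ x ⟨$⟩ʳ j → i ≡ j
value-injective x eq = trans (sym (inverseˡ x)) (trans (cong (x ⟨$⟩ˡ_) eq) (inverseˡ x))

-- `P` holds on an initial segment, and `r` is its length: the place where `sortBy` puts the next
-- value.
threshold : {P : Pred (Fin n) 0ℓ} → Decidable P → (∀ {s t} → s < t → P t → P s) →
  ∃ λ (r : Fin (suc n)) → ∀ s → (P s → toℕ s ℕ.< toℕ r) × (¬ P s → toℕ r ℕ.≤ toℕ s)
threshold {zero}  P? down = zero , λ ()
threshold {suc n} P? down with P? zero
... | no ¬P0 = zero , λ where
  zero    → (λ P0 → contradiction P0 ¬P0) , λ _ → z≤n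
  (suc s) → (λ Ps → contradiction (down (s≤s z≤n) Ps) ¬P0) , λ _ → z≤n
... | yes P0 with threshold (P? ∘ suc) (λ s<t → down (s≤s s<t))
...   | r , spec = suc r , λ where
  zero    → (λ _ → s≤s z≤n) , λ ¬P0 → contradiction P0 ¬P0
  (suc s) → s≤s ∘ proj₁ (spec s) , s≤s ∘ proj₂ (spec s)

punchIn-increasing : (r : Fin (suc n)) → Increasing (punchIn r)
punchIn-increasing r s<t = ℕₚ.≤∧≢⇒< (Finₚ.punchIn-mono-≤ r _ _ (ℕₚ.<⇒≤ s<t))
  (λ eq → ℕₚ.<⇒≢ s<t (cong toℕ (Finₚ.punchIn-injective r _ _ (Finₚ.toℕ-injective eq))))

punchIn-below : (r : Fin (suc n)) (s : Fin n) → toℕ s ℕ.< toℕ r → punchIn r s < r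
punchIn-below (suc r) zero    _         = s≤s z≤n
punchIn-below (suc r) (suc s) (s≤s s<r) = s≤s (punchIn-below r s s<r)

punchIn-above : (r : Fin (suc n)) (s : Fin n) → toℕ r ℕ.≤ toℕ s → r < punchIn r s
punchIn-above zero    s       _         = s≤s z≤n
punchIn-above (suc r) (suc s) (s≤s r≤s) = s≤s (punchIn-above r s r≤s)

insert-self : (r c : Fin (suc n)) (x : Perm n) → insert r c x ⟨$⟩ʳ r ≡ c
insert-self r c x with r Finₚ.≟ r
... | yes _ = refl
... | no r≢r = contradiction refl r≢r

pos-insert-self : (r c : Fin (suc n)) (x : Perm n) → pos (insert r c x) c ≡ r
pos-insert-self r c x =
  trans (cong (pos (insert r c x)) (sym (insert-self r c x))) (inverseˡ (insert r c x))

pos-insert-punchIn : (r c : Fin (suc n)) (x : Perm n) (t : Fin n) →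
  pos (insert r c x) (punchIn c t) ≡ punchIn r (pos x t)
pos-insert-punchIn r c x t = begin
  pos y (punchIn c t)                        ≡⟨ cong (λ s → pos y (punchIn c s)) (inverseʳ x) ⟨
  pos y (punchIn c (x ⟨$⟩ʳ pos x t))         ≡⟨ cong (pos y) (insert-punchIn r c x (pos x t)) ⟨
  pos y (y ⟨$⟩ʳ punchIn r (pos x t))         ≡⟨ inverseˡ y ⟩
  punchIn r (pos x t)                        ∎
  where
  open ≡-Reasoning
  y = insert r c x

SortedBy : (Fin n → ℕ) → Perm n → Set
SortedBy key x = ∀ {a b} → key a ℕ.< key b → pos x a < pos x b

module _ {key : Fin n → ℕ} (key-injective : Injective _≡_ _≡_ key) where

  sorted-cancel : (x : Perm n) → SortedBy key x → ∀ {a b} → pos x a < pos x b → key a ℕ.< key b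
  sorted-cancel x srt {a} {b} lt with ℕₚ.<-cmp (key a) (key b)
  ... | tri< ka<kb _ _ = ka<kb
  ... | tri≈ _ ka≡kb _ = contradiction lt (ℕₚ.<-irrefl (cong (toℕ ∘ pos x) (key-injective ka≡kb)))
  ... | tri> _ _ kb<ka = contradiction (srt kb<ka) (ℕₚ.<-asym lt)

-- Insertion sort, with value `zero` inserted into the sorted permutation of the other values. Keys
-- in ℕ leave room for doubling or shifting them.
sortBy : (key : Fin n → ℕ) → Injective _≡_ _≡_ key → ∃ (SortedBy key)
sortBy {zero}  key inj = id , λ { {()} }
sortBy {suc n} key inj with sortBy (key ∘ suc) (Finₚ.suc-injective ∘ inj)
... | x , srt = insert r zero x , λ {a} {b} → sorted a b
  where
  smaller : Pred (Fin n) 0ℓ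
  smaller s = key (suc (x ⟨$⟩ʳ s)) ℕ.< key zero

  down : ∀ {s t} → s < t → smaller t → smaller s
  down s<t = ℕₚ.<-trans (sorted-cancel (Finₚ.suc-injective ∘ inj) x srt
    (subst₂ _<_ (sym (inverseˡ x)) (sym (inverseˡ x)) s<t))

  r = proj₁ (threshold (λ s → key (suc (x ⟨$⟩ʳ s)) ℕₚ.<? key zero) down)
  spec = proj₂ (threshold (λ s → key (suc (x ⟨$⟩ʳ s)) ℕₚ.<? key zero) down)

  at-zero : pos (insert r zero x) zero ≡ r
  at-zero = pos-insert-self r zero x

  at-suc : ∀ t → pos (insert r zero x) (suc t) ≡ punchIn r (pos x t)
  at-suc = pos-insert-punchIn r zero x

  sorted : ∀ a b → key a ℕ.< key b → pos (insert r zero x) a < pos (insert r zero x) b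
  sorted zero zero lt = contradiction lt (ℕₚ.<-irrefl refl)
  sorted zero (suc t) lt = subst₂ _<_ (sym at-zero) (sym (at-suc t))
    (punchIn-above r (pos x t) (proj₂ (spec (pos x t))
      λ gt → ℕₚ.<-asym lt (subst (λ v → key (suc v) ℕ.< key zero) (inverseʳ x) gt)))
  sorted (suc s) zero lt = subst₂ _<_ (sym (at-suc s)) (sym at-zero)
    (punchIn-below r (pos x s) (proj₁ (spec (pos x s))
      (subst (λ v → key (suc v) ℕ.< key zero) (sym (inverseʳ x)) lt)))
  sorted (suc s) (suc t) lt = subst₂ _<_ (sym (at-suc s)) (sym (at-suc t)) (punchIn-increasing r (srt lt))

-- Edges of the weak order

inverted? : (x : Perm n) (a b : Fin n) → Dec (Inverted x a b)
inverted? x a b = (a Finₚ.<? b) ×-dec (pos x b Finₚ.<? pos x a)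

-- A cover relation that names the swapped values, so that edges of different permutations can be
-- compared.
record Edge (x y : Perm n) (a b : Fin n) : Set where
  field
    inverted : Inverted x a b
    removed  : ¬ Inverted y a b
    below    : y ≤ x
    rest     : ∀ {c d} → Inverted x c d → Inverted y c d ⊎ (c ≡ a × d ≡ b)

edge⇒⋖ : {x y : Perm n} {a b : Fin n} → Edge x y a b → y ⋖ x
edge⇒⋖ {x = x} {y} {a} {b} E = below , (λ x≤y → removed (x≤y inverted)) , between
  where
  open Edge E
  between : ∀ z → y ≤ z → z ≤ x → z ≤ y ⊎ x ≤ z
  between z y≤z z≤x with inverted? z a b
  ... | yes zab = inj₂ λ xcd → Sum.[ y≤z , (λ { (refl , refl) → zab }) ] (rest xcd)
  ... | no ¬zab = inj₁ λ zcd → Sum.[ (λ ycd → ycd) , (λ { (refl , refl) → contradiction zcd ¬zab }) ] (rest (z≤x zcd))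

module _ (x : Perm n) {a b : Fin n} (xab : Inverted x a b)
         (empty : ∀ e → pos x b < pos x e → ¬ (pos x e < pos x a)) where

  private
    a<b = proj₁ xab

    -- Moves b to just behind a; positions are doubled to make room.
    key : Fin n → ℕ
    key e with e Finₚ.≟ b
    ... | yes _ = suc (2 ℕ.* toℕ (pos x a))
    ... | no  _ = 2 ℕ.* toℕ (pos x e)

    key-b : key b ≡ suc (2 ℕ.* toℕ (pos x a))
    key-b with b Finₚ.≟ b
    ... | yes _   = refl
    ... | no  b≢b = contradiction refl b≢b

    key-≢ : ∀ {e} → e ≢ b → key e ≡ 2 ℕ.* toℕ (pos x e)
    key-≢ {e} e≢b with e Finₚ.≟ b
    ... | yes e≡b = contradiction e≡b e≢b
    ... | no  _   = refl

    key-injective : Injective _≡_ _≡_ key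
    key-injective {e} {f} eq with e Finₚ.≟ b | f Finₚ.≟ b
    ... | yes refl | yes refl = refl
    ... | yes refl | no _     = contradiction (sym eq) (ℕₚ.even≢odd (toℕ (pos x f)) (toℕ (pos x a)))
    ... | no _     | yes refl = contradiction eq (ℕₚ.even≢odd (toℕ (pos x e)) (toℕ (pos x a)))
    ... | no _     | no _     = pos-injective x (Finₚ.toℕ-injective (ℕₚ.*-cancelˡ-≡ _ _ 2 eq))

    key-mono : ∀ {c d} → pos x c < pos x d → ¬ (c ≡ b × d ≡ a) → key c ℕ.< key d
    key-mono {c} {d} c<d ≢ba = go (c Finₚ.≟ b) (d Finₚ.≟ b)
      where
      go : Dec (c ≡ b) → Dec (d ≡ b) → key c ℕ.< key d
      go (yes refl) (yes refl) = contradiction c<d (ℕₚ.<-irrefl refl)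
      go (yes refl) (no d≢b) = subst₂ ℕ._<_ (sym key-b) (sym (key-≢ d≢b))
        (subst (ℕ._≤ 2 ℕ.* toℕ (pos x d)) (ℕₚ.*-suc 2 _) (ℕₚ.*-monoʳ-≤ 2
          (≮∧≢⇒> (empty d c<d) λ eq → ≢ba (refl , pos-injective x eq))))
      go (no c≢b) (yes refl) = subst₂ ℕ._<_ (sym (key-≢ c≢b)) (sym key-b)
        (s≤s (ℕₚ.*-monoʳ-≤ 2 (ℕₚ.<⇒≤ (ℕₚ.<-trans c<d (proj₂ xab)))))
      go (no c≢b) (no d≢b) = subst₂ ℕ._<_ (sym (key-≢ c≢b)) (sym (key-≢ d≢b)) (ℕₚ.*-monoʳ-< 2 c<d)

  uncover : ∃ λ y → Edge x y a b
  uncover with sortBy key key-injective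
  ... | y , srt = y , record
    { inverted = xab
    ; removed  = λ (_ , b<a) → ℕₚ.<-asym b<a (srt (subst₂ ℕ._<_ (sym (key-≢ (Finₚ.<⇒≢ a<b))) (sym key-b) ℕₚ.≤-refl))
    ; below    = λ { {c} {d} (c<d , dc) → c<d , Sum.[ (λ cd → contradiction dc (ℕₚ.<-asym (srt
                     (key-mono cd λ { (refl , refl) → ℕₚ.<-asym a<b c<d })))) , (λ dc′ → dc′) ]
                     (pos-connex x (Finₚ.<⇒≢ c<d)) }
    ; rest     = rest
    }
    where
    rest : ∀ {c d} → Inverted x c d → Inverted y c d ⊎ (c ≡ a × d ≡ b)
    rest {c} {d} (c<d , dc) with (d Finₚ.≟ b) ×-dec (c Finₚ.≟ a)
    ... | yes (d≡b , c≡a) = inj₂ (c≡a , d≡b)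
    ... | no ≢ba = inj₁ (c<d , srt (key-mono dc ≢ba))

-- Arcs

Label : ℕ → Set
Label n = Fin n → Bool

-- For `true` these pairs are the inversions of the join-irreducible of the arc, for `false` the
-- noninversions of its meet-irreducible. The ends count as labelled `not s` and `s`. The Boolean
-- makes one duality proof serve both directions.
Admissible : Bool → Label n → Fin n → Fin n → Rel (Fin n) 0ℓ
Admissible s ε a b e f =
  a Fin.≤ e × e < f × f Fin.≤ b × (e ≡ a ⊎ ε e ≡ not s) × (f ≡ b ⊎ ε f ≡ s)

admissible? : ∀ s (ε : Label n) a b e f → Dec (Admissible s ε a b e f)
admissible? s ε a b e f = (a Finₚ.≤? e) ×-dec (e Finₚ.<? f) ×-dec (f Finₚ.≤? b)
  ×-dec ((e Finₚ.≟ a) ⊎-dec (ε e Boolₚ.≟ not s)) ×-dec ((f Finₚ.≟ b) ⊎-dec (ε f Boolₚ.≟ s))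

Ordered : Bool → Perm n → Rel (Fin n) 0ℓ
Ordered true  x e f = pos x f < pos x e
Ordered false x e f = pos x e < pos x f

-- An arc (ε , a , b) chooses, for each value strictly between a and b, whether
-- it lies left (true) or right (false) of a and b.  Follows true says that x is
-- above the join-irreducible of the arc, and Follows false that x is below its
-- meet-irreducible.
Follows : Bool → Label n → Fin n → Fin n → Pred (Perm n) 0ℓ
Follows s ε a b x = ∀ {e f} → Admissible s ε a b e f → Ordered s x e f

ordered-trans : ∀ s (x : Perm n) {e f g} → Ordered s x e f → Ordered s x f g → Ordered s x e g
ordered-trans true  x ef fg = ℕₚ.<-trans fg ef
ordered-trans false x ef fg = ℕₚ.<-trans ef fg

ordered-flip : ∀ s (x : Perm n) {e f} → Ordered (not s) x e f → Ordered s x f e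
ordered-flip true  x ef = ef
ordered-flip false x ef = ef

ordered-asym : ∀ s (x : Perm n) {e f} → Ordered s x e f → ¬ Ordered (not s) x e f
ordered-asym true  x = ℕₚ.<-asym
ordered-asym false x = ℕₚ.<-asym

ordered-connex : ∀ s (x : Perm n) {e f} → e ≢ f → Ordered (not s) x e f ⊎ Ordered s x e f
ordered-connex true  x = pos-connex x
ordered-connex false x = Sum.swap ∘ pos-connex x

-- Here `B` will be an undecidable match: it is either found at some `i`, or all the `A i` are
-- available at once.
distribute : {A : Pred (Fin n) 0ℓ} {B : Set} → (∀ i → A i ⊎ B) → (∀ i → A i) ⊎ B
distribute {zero}  f = inj₁ λ ()
distribute {suc n} f with f zero | distribute (f ∘ suc)
... | inj₂ b  | _       = inj₂ b
... | inj₁ _  | inj₂ b  = inj₂ b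
... | inj₁ a₀ | inj₁ as = inj₁ λ { zero → a₀ ; (suc i) → as i }

distribute₂ : {A : Rel (Fin n) 0ℓ} {B : Set} → (∀ i j → A i j ⊎ B) → (∀ i j → A i j) ⊎ B
distribute₂ f = distribute λ i → distribute (f i)

-- A pair of minimal difference violating the conclusion spans a subarc which y
-- follows in the sense s, but x does not.
follows-dual : ∀ s {x y : Perm n} {M : Label n → Rel (Fin n) 0ℓ} →
  (∀ {ε a b c d} → a Fin.≤ c → d Fin.≤ b → M ε c d → M ε a b) →
  (∀ ε a b → Follows s ε a b y → Follows s ε a b x ⊎ M ε a b) →
  ∀ ε a b → Follows (not s) ε a b x → Follows (not s) ε a b y ⊎ M ε a b
follows-dual {n} s {x} {y} {M} M-mono y⇒x ε a b Fx =
  Sum.map₁ (λ F {c} {d} → F c d (ℕₚ.<⇒≤ (ℕₚ.<-≤-trans (Finₚ.toℕ<n d) (ℕₚ.m≤m+n n (toℕ c))))) (upTo n)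
  where
  Ok : ℕ → Rel (Fin n) 0ℓ
  Ok g c d = toℕ d ℕ.≤ g ℕ.+ toℕ c → Admissible (not s) ε a b c d → Ordered (not s) y c d

  upTo : ∀ g → (∀ c d → Ok g c d) ⊎ M ε a b
  upTo zero = inj₁ λ c d d≤c (_ , c<d , _) → contradiction c<d (ℕₚ.≤⇒≯ d≤c)
  upTo (suc g) with upTo g
  ... | inj₂ m     = inj₂ m
  ... | inj₁ small = distribute₂ step
    where
    step : ∀ c d → Ok (suc g) c d ⊎ M ε a b
    step c d with toℕ d ℕₚ.≤? suc g ℕ.+ toℕ c | admissible? (not s) ε a b c d
    ... | no d≰ | _ = inj₁ λ d≤ → contradiction d≤ d≰
    ... | yes _ | no ¬adm = inj₁ λ _ adm → contradiction adm ¬adm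
    ... | yes d≤ | yes adm@(a≤c , c<d , d≤b , c-label , d-label)
      with ordered-connex s y (Finₚ.<⇒≢ c<d)
    ... | inj₁ cd = inj₁ λ _ _ → cd
    ... | inj₂ cd with y⇒x ε c d (λ {e} {f} → Fy {e} {f})
      where
      -- An inner value labelled `not s` forms with `c`, and one labelled `s` with `d`, an
      -- admissible pair of smaller difference. By minimality `y` orders these pairs in the sense
      -- `not s`; chained through `cd` they give all of the subarc. If `x` followed the subarc as
      -- well, the pair of its ends would contradict `Fx`.
      Fy : Follows s ε c d y
      Fy {e} {f} (c≤e , e<f , f≤d , e-label , f-label) = to-f (≤⇒<∨≡ f≤d) f-label
        where
        to-d : c < e ⊎ c ≡ e → (e ≡ c ⊎ ε e ≡ not s) → Ordered s y e d
        to-d (inj₂ refl) _ = cd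
        to-d (inj₁ c<e) (inj₁ refl) = contradiction c<e (ℕₚ.<-irrefl refl)
        to-d (inj₁ c<e) (inj₂ εe) = ordered-trans s y (ordered-flip s y
          (small c e (ℕₚ.≤-pred (ℕₚ.≤-trans (ℕₚ.≤-trans e<f f≤d) d≤))
            (a≤c , c<e , ℕₚ.≤-trans (ℕₚ.<⇒≤ e<f) (ℕₚ.≤-trans f≤d d≤b) , c-label , inj₂ εe))) cd

        ed : Ordered s y e d
        ed = to-d (≤⇒<∨≡ c≤e) e-label

        to-f : f < d ⊎ f ≡ d → (f ≡ d ⊎ ε f ≡ s) → Ordered s y e f
        to-f (inj₂ refl) _ = ed
        to-f (inj₁ f<d) (inj₁ refl) = contradiction f<d (ℕₚ.<-irrefl refl)
        to-f (inj₁ f<d) (inj₂ εf) = ordered-trans s y ed (ordered-flip s y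
          (small f d (ℕₚ.≤-trans d≤ (subst (ℕ._≤ g ℕ.+ toℕ f) (ℕₚ.+-suc g (toℕ c)) (ℕₚ.+-monoʳ-≤ g (ℕₚ.≤-<-trans c≤e e<f))))
            (ℕₚ.≤-trans a≤c (ℕₚ.≤-trans c≤e (ℕₚ.<⇒≤ e<f)) , f<d , d≤b , inj₂ (trans εf (sym (Boolₚ.not-involutive s))) , d-label)))
    ...   | inj₂ m = inj₂ (M-mono a≤c d≤b m)
    ...   | inj₁ F = contradiction (Fx adm) (ordered-asym s x (F (ℕₚ.≤-refl , c<d , ℕₚ.≤-refl , inj₁ refl , inj₁ refl)))

-- The join-irreducible of an arc

module _ (ε : Label n) {a b : Fin n} (a<b : a < b) where

  private
    -- The complement of the subset A associated with the join-irreducible, so that a = min A and b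
    -- is the largest value outside A.
    Left : Pred (Fin n) 0ℓ
    Left e = e < a ⊎ (a < e × e Fin.≤ b × (e ≡ b ⊎ ε e ≡ true))

    left? : Decidable Left
    left? e = (e Finₚ.<? a) ⊎-dec ((a Finₚ.<? e) ×-dec (e Finₚ.≤? b) ×-dec ((e Finₚ.≟ b) ⊎-dec (ε e Boolₚ.≟ true)))

    -- The shift by `n` puts A behind its complement and keeps both blocks increasing.
    key : Fin n → ℕ
    key e with left? e
    ... | yes _ = toℕ e
    ... | no  _ = n ℕ.+ toℕ e

    key-left : ∀ {e} → Left e → key e ≡ toℕ e
    key-left {e} l with left? e
    ... | yes _ = refl
    ... | no ¬l = contradiction l ¬l

    key-right : ∀ {e} → ¬ Left e → key e ≡ n ℕ.+ toℕ e
    key-right {e} ¬l with left? e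
    ... | yes l = contradiction l ¬l
    ... | no _  = refl

    key-injective : Injective _≡_ _≡_ key
    key-injective {e} {f} eq with left? e | left? f
    ... | yes _ | yes _ = Finₚ.toℕ-injective eq
    ... | yes _ | no _  = contradiction (subst (ℕ._< n) eq (Finₚ.toℕ<n e)) (ℕₚ.m+n≮m n (toℕ f))
    ... | no _  | yes _ = contradiction (subst (ℕ._< n) (sym eq) (Finₚ.toℕ<n f)) (ℕₚ.m+n≮m n (toℕ e))
    ... | no _  | no _  = Finₚ.toℕ-injective (ℕₚ.+-cancelˡ-≡ n _ _ eq)

    key-across : ∀ {e f} → Left e → ¬ Left f → key e ℕ.< key f
    key-across {e} {f} l ¬l = subst₂ ℕ._<_ (sym (key-left l)) (sym (key-right ¬l))
      (ℕₚ.<-≤-trans (Finₚ.toℕ<n e) (ℕₚ.m≤m+n n (toℕ f)))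

    key-inverted : ∀ {e f} → e < f → key f ℕ.< key e → Left f × ¬ Left e
    key-inverted {e} {f} e<f lt with left? e | left? f
    ... | yes _ | yes _ = contradiction lt (ℕₚ.<-asym e<f)
    ... | no ¬l | yes l = l , ¬l
    ... | yes _ | no _  = contradiction (ℕₚ.<-trans lt (Finₚ.toℕ<n e)) (ℕₚ.m+n≮m n (toℕ f))
    ... | no _  | no _  = contradiction (ℕₚ.+-cancelˡ-< n _ _ lt) (ℕₚ.<-asym e<f)

    sides⇒admissible : ∀ {e f} → e < f → Left f → ¬ Left e → Admissible true ε a b e f
    sides⇒admissible {e} {f} e<f lf ¬le = a≤e , e<f , proj₁ f-side , e-label , proj₂ f-side
      where
      a≤e : a Fin.≤ e
      a≤e = ℕₚ.≮⇒≥ (¬le ∘ inj₁)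

      f-side : f Fin.≤ b × (f ≡ b ⊎ ε f ≡ true)
      f-side = Sum.[ (λ f<a → contradiction (ℕₚ.<-trans e<f f<a) (ℕₚ.≤⇒≯ a≤e)) , proj₂ ] lf

      e-label : e ≡ a ⊎ ε e ≡ false
      e-label with ≤⇒<∨≡ a≤e
      ... | inj₂ a≡e = inj₁ (sym a≡e)
      ... | inj₁ a<e = inj₂ (Boolₚ.¬-not λ εe → ¬le (inj₂ (a<e , ℕₚ.<⇒≤ (ℕₚ.<-≤-trans e<f (proj₁ f-side)) , inj₂ εe)))

    admissible⇒sides : ∀ {e f} → Admissible true ε a b e f → Left f × ¬ Left e
    admissible⇒sides {e} {f} (a≤e , e<f , f≤b , e-label , f-label) = inj₂ (ℕₚ.≤-<-trans a≤e e<f , f≤b , f-label) , ¬left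
      where
      ¬left : ¬ Left e
      ¬left (inj₁ e<a) = ℕₚ.<⇒≱ e<a a≤e
      ¬left (inj₂ (a<e , _ , inj₁ e≡b)) = ℕₚ.<⇒≱ (ℕₚ.<-≤-trans e<f f≤b) (ℕₚ.≤-reflexive (cong toℕ (sym e≡b)))
      ¬left (inj₂ (a<e , _ , inj₂ εe)) =
        Sum.[ (λ e≡a → Finₚ.<⇒≢ a<e (sym e≡a)) , (λ εe′ → contradiction (trans (sym εe) εe′) λ ()) ] e-label

    sorted = sortBy key key-injective

  arcJoinIrreducible : Perm n
  arcJoinIrreducible = proj₁ sorted

  arc-follows : Follows true ε a b arcJoinIrreducible
  arc-follows adm = let l , ¬l = admissible⇒sides adm in proj₂ sorted (key-across l ¬l)

  arc-≤ : ∀ {x} → Follows true ε a b x → arcJoinIrreducible ≤ x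
  arc-≤ F (e<f , lt) = e<f ,
    (let l , ¬l = key-inverted e<f (sorted-cancel key-injective arcJoinIrreducible (proj₂ sorted) lt)
     in F (sides⇒admissible e<f l ¬l))

  arc-ends : Admissible true ε a b a b
  arc-ends = ℕₚ.≤-refl , a<b , ℕₚ.≤-refl , inj₁ refl , inj₁ refl

  -- `b` is the largest value of the left block and `a` the smallest of the right one, so they meet
  -- at the descent.
  arc-empty : ∀ e → pos arcJoinIrreducible b < pos arcJoinIrreducible e →
              ¬ (pos arcJoinIrreducible e < pos arcJoinIrreducible a)
  arc-empty e b<e e<a = go (left? e)
    where
    cancel : ∀ {e f} → pos arcJoinIrreducible e < pos arcJoinIrreducible f → key e ℕ.< key f
    cancel = sorted-cancel key-injective arcJoinIrreducible (proj₂ sorted)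

    lb = proj₁ (admissible⇒sides arc-ends)
    ¬la = proj₂ (admissible⇒sides arc-ends)

    go : ¬ Dec (Left e)
    go (yes l) with subst₂ ℕ._<_ (key-left lb) (key-left l) (cancel b<e) | l
    ... | b<e′ | inj₁ e<a = ℕₚ.<-asym (ℕₚ.<-trans e<a a<b) b<e′
    ... | b<e′ | inj₂ (_ , e≤b , _) = ℕₚ.<⇒≱ b<e′ e≤b
    go (no ¬l) = ¬l (inj₁ (ℕₚ.+-cancelˡ-< n _ _ (subst₂ ℕ._<_ (key-right ¬l) (key-right ¬la) (cancel e<a))))

-- Arcs under the weak order, meets and joins

follows-mono : ∀ {ε : Label n} {a b} {x y : Perm n} → x ≤ y → Follows true ε a b x → Follows true ε a b y
follows-mono x≤y F adm@(_ , e<f , _) = proj₂ (x≤y (e<f , F adm))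

follows-anti : ∀ {ε : Label n} {a b} {x y : Perm n} → x ≤ y → Follows false ε a b y → Follows false ε a b x
follows-anti {x = x} x≤y F adm@(_ , e<f , _) with pos-connex x (Finₚ.<⇒≢ e<f)
... | inj₁ lt = lt
... | inj₂ gt = contradiction (proj₂ (x≤y (e<f , gt))) (ℕₚ.<-asym (F adm))

-- The join-irreducible lies below `x` and `y`, hence below their meet. It exists only for `a < b`,
-- which any admissible pair guarantees.
follows-meet : ∀ {ε : Label n} {a b} {x y z : Perm n} → IsMeet x y z →
  Follows true ε a b x → Follows true ε a b y → Follows true ε a b z
follows-meet {ε = ε} {x = x} {y} {z} meet Fx Fy adm@(a≤e , e<f , f≤b , _) =
  follows-mono {x = arcJoinIrreducible ε a<b} {z} (IsMeet.greatest meet (arcJoinIrreducible ε a<b) (arc-≤ ε a<b {x} Fx) (arc-≤ ε a<b {y} Fy))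
    (arc-follows ε a<b) adm
  where a<b = ℕₚ.≤-<-trans a≤e (ℕₚ.<-≤-trans e<f f≤b)

opposite-anti : {i j : Fin n} → i < j → opposite j < opposite i
opposite-anti {n} {i} {j} i<j = subst₂ ℕ._<_ (sym (Finₚ.opposite-prop j)) (sym (Finₚ.opposite-prop i))
  (ℕₚ.∸-monoʳ-< (s≤s i<j) (Finₚ.toℕ<n j))

reversed : Perm n → Perm n
reversed x = reverse ∘ₚ x

-- Reversing the one-line notation exchanges joins with meets, and join-irreducibles
-- with meet-irreducibles of the complementary arcs.
follows-reversed : ∀ {ε : Label n} {a b} {x : Perm n} →
  Follows false ε a b x → Follows true (not ∘ ε) a b (reversed x)
follows-reversed {ε = ε} F (a≤e , e<f , f≤b , e-label , f-label) =
  opposite-anti (F (a≤e , e<f , f≤b , Sum.map₂ (λ h → trans (sym (Boolₚ.not-involutive _)) (cong not h)) e-label ,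
    Sum.map₂ (λ h → trans (sym (Boolₚ.not-involutive _)) (cong not h)) f-label))

≤-reversed : {g x : Perm n} → g ≤ reversed x → x ≤ reversed g
≤-reversed {g = g} g≤ (c<d , dc) with pos-connex g (Finₚ.<⇒≢ c<d)
... | inj₁ cd = c<d , opposite-anti cd
... | inj₂ dc′ = contradiction (opposite-anti dc) (ℕₚ.<-asym (proj₂ (g≤ (c<d , dc′))))

follows-join : ∀ {ε : Label n} {a b} {x y z : Perm n} → IsJoin x y z →
  Follows false ε a b x → Follows false ε a b y → Follows false ε a b z
follows-join {ε = ε} {a} {b} {x} {y} {z} join Fx Fy =
  λ adm@(a≤e , e<f , f≤b , _) → from-bound (ℕₚ.≤-<-trans a≤e (ℕₚ.<-≤-trans e<f f≤b)) adm
  where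
  from-bound : a < b → Follows false ε a b z
  from-bound a<b = follows-anti {x = z} {reversed g} z≤ Fg
    where
    g = arcJoinIrreducible (not ∘ ε) a<b

    bound : ∀ {w} → Follows false ε a b w → w ≤ reversed g
    bound {w} Fw = ≤-reversed {g = g} {w} (arc-≤ (not ∘ ε) a<b {reversed w} (follows-reversed {x = w} Fw))

    z≤ : z ≤ reversed g
    z≤ = IsJoin.least join (reversed g) (bound {x} Fx) (bound {y} Fy)

    Fg : Follows false ε a b (reversed g)
    Fg (a≤e , e<f , f≤b , e-label , f-label) = opposite-anti (arc-follows (not ∘ ε) a<b
      (a≤e , e<f , f≤b , Sum.map₂ (cong not) e-label , Sum.map₂ (cong not) f-label))

-- Shuffles

-- The common form of `u ⊗ v` and φ_Q(u,v), where `α` and `β` list the values of the two blocks. It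
-- allows one argument for both axioms.
record Shuffle (α : Fin p → Fin n) (β : Fin q → Fin n) (u : Perm p) (v : Perm q) (x : Perm n) : Set where
  field
    left   : ∀ {s t} → pos u s < pos u t ⇔ pos x (α s) < pos x (α t)
    right  : ∀ {s t} → pos v s < pos v t ⇔ pos x (β s) < pos x (β t)
    across : ∀ s t → pos x (α s) < pos x (β t)

↑ˡ-increasing : Increasing {m} (_↑ˡ n)
↑ˡ-increasing {n = n} {i} {j} = subst₂ ℕ._<_ (sym (Finₚ.toℕ-↑ˡ i n)) (sym (Finₚ.toℕ-↑ˡ j n))

↑ʳ-increasing : Increasing {n} (m ↑ʳ_)
↑ʳ-increasing {m = m} {i} {j} i<j = subst₂ ℕ._<_ (sym (Finₚ.toℕ-↑ʳ m i)) (sym (Finₚ.toℕ-↑ʳ m j)) (ℕₚ.+-monoʳ-< m i<j)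

↑ˡ<↑ʳ : (i : Fin m) (j : Fin n) → i ↑ˡ n < m ↑ʳ j
↑ˡ<↑ʳ {m} {n} i j = subst₂ ℕ._<_ (sym (Finₚ.toℕ-↑ˡ i n)) (sym (Finₚ.toℕ-↑ʳ m j))
  (ℕₚ.<-≤-trans (Finₚ.toℕ<n i) (ℕₚ.m≤m+n m (toℕ j)))

module _ {α : Fin p → Fin (p ℕ.+ q)} {β : Fin q → Fin (p ℕ.+ q)} {u : Perm p} {v : Perm q} {x : Perm (p ℕ.+ q)}
         (pos-α : ∀ s → pos x (α s) ≡ pos u s ↑ˡ q) (pos-β : ∀ t → pos x (β t) ≡ p ↑ʳ pos v t) where

  shuffle : Shuffle α β u v x
  shuffle = record
    { left   = λ {s} {t} → mk⇔ (subst₂ _<_ (sym (pos-α s)) (sym (pos-α t)) ∘ ↑ˡ-increasing)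
                               (increasing-cancel (↑ˡ-increasing {n = q}) ∘ subst₂ _<_ (pos-α s) (pos-α t))
    ; right  = λ {s} {t} → mk⇔ (subst₂ _<_ (sym (pos-β s)) (sym (pos-β t)) ∘ ↑ʳ-increasing)
                               (increasing-cancel (↑ʳ-increasing {m = p}) ∘ subst₂ _<_ (pos-β s) (pos-β t))
    ; across = λ s t → subst₂ _<_ (sym (pos-α s)) (sym (pos-β t)) (↑ˡ<↑ʳ (pos u s) (pos v t))
    }

split : ∀ p (c : Fin (p ℕ.+ q)) → (∃ λ (s : Fin p) → s ↑ˡ q ≡ c) ⊎ (∃ λ (t : Fin q) → p ↑ʳ t ≡ c)
split p c with Fin.splitAt p c in eq
... | inj₁ s = inj₁ (s , Finₚ.splitAt⁻¹-↑ˡ eq)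
... | inj₂ t = inj₂ (t , Finₚ.splitAt⁻¹-↑ʳ eq)

shuffle-⊗ : (u : Perm p) (v : Perm q) → Shuffle (_↑ˡ q) (p ↑ʳ_) u v (u ⊗ v)
shuffle-⊗ {p} {q} u v = shuffle {u = u} {v} {u ⊗ v}
  (λ s → cong (Fin.join p q ∘ Sum.map (pos u) (pos v)) (Finₚ.splitAt-↑ˡ p s q))
  (λ t → cong (Fin.join p q ∘ Sum.map (pos u) (pos v)) (Finₚ.splitAt-↑ʳ p q t))

↑ˡ-convex : ∀ {a b : Fin p} {e : Fin (p ℕ.+ q)} → a ↑ˡ q Fin.≤ e → e Fin.≤ b ↑ˡ q → ∃ λ r → r ↑ˡ q ≡ e
↑ˡ-convex {p} {b = b} {e} _ e≤b with split p e
... | inj₁ r = r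
... | inj₂ (t , refl) = contradiction e≤b (ℕₚ.<⇒≱ (↑ˡ<↑ʳ b t))

↑ʳ-convex : ∀ {a b : Fin q} {e : Fin (p ℕ.+ q)} → p ↑ʳ a Fin.≤ e → e Fin.≤ p ↑ʳ b → ∃ λ r → p ↑ʳ r ≡ e
↑ʳ-convex {p = p} {a} {e = e} a≤e _ with split p e
... | inj₂ r = r
... | inj₁ (s , refl) = contradiction a≤e (ℕₚ.<⇒≱ (↑ˡ<↑ʳ s a))

-- Factoring `α` through `α′` gives an increasing self-map of `Fin m`, which is the identity. Thus
-- the set `Q` alone determines how its values are listed.
increasing-unique : {α α′ : Fin m → Fin n} → Increasing α → Increasing α′ →
  (∀ t → ∃ λ s → α′ s ≡ α t) → ∀ t → α t ≡ α′ t
increasing-unique {α = α} {α′} α↑ α′↑ image t =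
  trans (sym (proj₂ (image t))) (cong α′ (increasing-id s↑ t))
  where
  s↑ : Increasing (proj₁ ∘ image)
  s↑ t<u = increasing-cancel α′↑ (subst₂ _<_ (sym (proj₂ (image _))) (sym (proj₂ (image _))) (α↑ t<u))

module Insertion {p q} {Q : Subset (p ℕ.+ q)} {u : Perm p} {v : Perm q} {x : Perm (p ℕ.+ q)}
                 (I : IsInsertion Q u v x) where
  open IsInsertion I
  open Equivalence

  -- The element of rank `s` in `Q`, found in `x` where `u` has the value `s`.
  α : Fin p → Fin (p ℕ.+ q)
  α s = x ⟨$⟩ʳ (pos u s ↑ˡ q)

  β : Fin q → Fin (p ℕ.+ q)
  β t = x ⟨$⟩ʳ (p ↑ʳ pos v t)

  α↑ : Increasing α
  α↑ s<t = to (prefix-std _ _) (subst₂ _<_ (sym (inverseʳ u)) (sym (inverseʳ u)) s<t)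

  β↑ : Increasing β
  β↑ s<t = to (suffix-std _ _) (subst₂ _<_ (sym (inverseʳ v)) (sym (inverseʳ v)) s<t)

  α∈Q : ∀ s → α s ∈ Q
  α∈Q s = from (prefix-set _) (pos u s , refl)

  Q⊆α : ∀ {c} → c ∈ Q → ∃ λ s → α s ≡ c
  Q⊆α c∈Q with to (prefix-set _) c∈Q
  ... | i , eq = u ⟨$⟩ʳ i , trans (cong (λ j → x ⟨$⟩ʳ (j ↑ˡ q)) (inverseˡ u)) eq

  β∉Q : ∀ t → ¬ (β t ∈ Q)
  β∉Q t β∈Q with Q⊆α β∈Q
  ... | s , eq = ℕₚ.<-irrefl (cong toℕ (value-injective x eq)) (↑ˡ<↑ʳ (pos u s) (pos v t))

  onto : ∀ c → (∃ λ s → α s ≡ c) ⊎ (∃ λ t → β t ≡ c)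
  onto c with split p (pos x c)
  ... | inj₁ (i , eq) = inj₁ (u ⟨$⟩ʳ i , trans (cong (λ j → x ⟨$⟩ʳ (j ↑ˡ q)) (inverseˡ u)) (trans (cong (x ⟨$⟩ʳ_) eq) (inverseʳ x)))
  ... | inj₂ (j , eq) = inj₂ (v ⟨$⟩ʳ j , trans (cong (λ j → x ⟨$⟩ʳ (p ↑ʳ j)) (inverseˡ v)) (trans (cong (x ⟨$⟩ʳ_) eq) (inverseʳ x)))

  ∉Q⊆β : ∀ {c} → ¬ (c ∈ Q) → ∃ λ t → β t ≡ c
  ∉Q⊆β {c} c∉Q with onto c
  ... | inj₁ (s , refl) = contradiction (α∈Q s) c∉Q
  ... | inj₂ r = r

  insertion-shuffle : {α′ : Fin p → Fin (p ℕ.+ q)} {β′ : Fin q → Fin (p ℕ.+ q)} →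
    (∀ s → α′ s ≡ α s) → (∀ t → β′ t ≡ β t) → Shuffle α′ β′ u v x
  insertion-shuffle α≗ β≗ = shuffle {u = u} {v} {x}
    (λ s → trans (cong (pos x) (α≗ s)) (inverseˡ x)) (λ t → trans (cong (pos x) (β≗ t)) (inverseˡ x))

-- The congruences defined by sets of arcs

module ArcCongruence (C : PermSet) where

  -- The left/right word of some γ in C is a subword of that of the arc.  The ends
  -- of γ may go to any values in [a,b]: moving them to a and b is harmless.
  record Match (ε : Label n) (a b : Fin n) : Set where
    field
      {size}  : ℕ
      γ       : Perm size
      γ∈C     : C size γ
      {j j′}  : Fin size
      descent : Descent γ j j′
      ι       : Fin size → Fin n
      ι↑      : Increasing ι
      lower   : ∀ v → a Fin.≤ ι v
      upper   : ∀ v → ι v Fin.≤ b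
      left    : ∀ {s} → s < j → ε (ι (γ ⟨$⟩ʳ s)) ≡ true
      right   : ∀ {s} → j′ < s → ε (ι (γ ⟨$⟩ʳ s)) ≡ false

  match-mono : ∀ {ε : Label n} {a b c d} → a Fin.≤ c → d Fin.≤ b → Match ε c d → Match ε a b
  match-mono a≤c d≤b M = record
    { γ = γ ; γ∈C = γ∈C ; descent = descent ; ι = ι ; ι↑ = ι↑
    ; lower = λ v → ℕₚ.≤-trans a≤c (lower v) ; upper = λ v → ℕₚ.≤-trans (upper v) d≤b
    ; left = left ; right = right }
    where open Match M

  infix 4 _⊑_

  _⊑_ : Rel (Perm n) 0ℓ
  x ⊑ y = ∀ ε a b → Follows true ε a b x → Follows true ε a b y ⊎ Match ε a b

  Θ : Family
  Θ n x y = x ⊑ y × y ⊑ x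

  ⊑-trans : {x y z : Perm n} → x ⊑ y → y ⊑ z → x ⊑ z
  ⊑-trans x⊑y y⊑z ε a b F = Sum.[ y⊑z ε a b , inj₂ ] (x⊑y ε a b F)

  meet-⊑ : {x x′ y y′ z z′ : Perm n} → x ⊑ x′ → y ⊑ y′ → IsMeet x y z → IsMeet x′ y′ z′ → z ⊑ z′
  meet-⊑ {x = x} {x′} {y} {y′} {z} {z′} x⊑x′ y⊑y′ m m′ ε a b F
    with x⊑x′ ε a b (follows-mono {x = z} {x} (IsMeet.left m) F)
       | y⊑y′ ε a b (follows-mono {x = z} {y} (IsMeet.right m) F)
  ... | inj₂ M  | _       = inj₂ M
  ... | inj₁ _  | inj₂ M  = inj₂ M
  ... | inj₁ Fx | inj₁ Fy = inj₁ (λ {_} {_} → follows-meet {x = x′} {y′} {z′} m′ Fx Fy)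

  -- Joins behave well only with respect to meet-irreducibles. Dualizing reverses both hypotheses;
  -- the join is taken on that side, and dualizing once more restores the direction.
  join-⊑ : {x x′ y y′ z z′ : Perm n} → x ⊑ x′ → y ⊑ y′ → IsJoin x y z → IsJoin x′ y′ z′ → z ⊑ z′
  join-⊑ {x = x} {x′} {y} {y′} {z} {z′} x⊑x′ y⊑y′ m m′ = follows-dual false {z} {z′} match-mono dual
    where
    dual : ∀ ε a b → Follows false ε a b z′ → Follows false ε a b z ⊎ Match ε a b
    dual ε a b F
      with follows-dual true {x′} {x} match-mono x⊑x′ ε a b (follows-anti {x = x′} {z′} (IsJoin.left m′) F)
         | follows-dual true {y′} {y} match-mono y⊑y′ ε a b (follows-anti {x = y′} {z′} (IsJoin.right m′) F)
    ... | inj₂ M  | _       = inj₂ M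
    ... | inj₁ _  | inj₂ M  = inj₂ M
    ... | inj₁ Fx | inj₁ Fy = inj₁ (λ {_} {_} → follows-join {x = x} {y} {z} m Fx Fy)

  Θ-isCongruence : ∀ n → IsCongruence (Θ n)
  Θ-isCongruence n = record
    { isEquivalence = record
      { refl  = λ {x} → (λ _ _ _ F → inj₁ F) , (λ _ _ _ F → inj₁ F)
      ; sym   = λ (p , q) → q , p
      ; trans = λ {x} {y} {z} (p , q) (p′ , q′) → ⊑-trans {x = x} {y} {z} p p′ , ⊑-trans {x = z} {y} {x} q′ q
      }
    ; join-cong = λ {x} {x′} {y} {y′} {z} {z′} (p , q) (p′ , q′) m m′ →
        join-⊑ {x = x} {x′} {y} {y′} {z} {z′} p p′ m m′ , join-⊑ {x = x′} {x} {y′} {y} {z′} {z} q q′ m′ m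
    ; meet-cong = λ {x} {x′} {y} {y′} {z} {z′} (p , q) (p′ , q′) m m′ →
        meet-⊑ {x = x} {x′} {y} {y′} {z} {z′} p p′ m m′ , meet-⊑ {x = x′} {x} {y′} {y} {z′} {z} q q′ m′ m
    }

  module _ {h : Fin m → Fin n} (h↑ : Increasing h) where

    admissible-image : ∀ s {ε : Label n} {a b} {e f} →
      Admissible s (ε ∘ h) a b e f → Admissible s ε (h a) (h b) (h e) (h f)
    admissible-image s (a≤e , e<f , f≤b , e-label , f-label) =
      increasing-≤ h↑ a≤e , h↑ e<f , increasing-≤ h↑ f≤b , Sum.map₁ (cong h) e-label , Sum.map₁ (cong h) f-label

    match-image : ∀ {ε : Label n} {a b} → Match (ε ∘ h) a b → Match ε (h a) (h b)
    match-image M = record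
      { γ = γ ; γ∈C = γ∈C ; descent = descent ; ι = h ∘ ι ; ι↑ = h↑ ∘ ι↑
      ; lower = λ v → increasing-≤ h↑ (lower v) ; upper = λ v → increasing-≤ h↑ (upper v)
      ; left = left ; right = right }
      where open Match M

    module _ (convex : ∀ {a b e} → h a Fin.≤ e → e Fin.≤ h b → ∃ λ r → h r ≡ e) where

      match-preimage : ∀ {ε : Label n} {ε₀ : Label m} {a b} → (∀ s → ε (h s) ≡ ε₀ s) →
        Match ε (h a) (h b) → Match ε₀ a b
      match-preimage {ε} {ε₀} ε≗ M = record
        { γ = γ ; γ∈C = γ∈C ; descent = descent ; ι = ι₀
        ; ι↑ = λ v<w → increasing-cancel h↑ (subst₂ _<_ (sym (h-ι₀ _)) (sym (h-ι₀ _)) (ι↑ v<w))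
        ; lower = λ v → increasing-cancel-≤ h↑ (subst (h _ Fin.≤_) (sym (h-ι₀ v)) (lower v))
        ; upper = λ v → increasing-cancel-≤ h↑ (subst (Fin._≤ h _) (sym (h-ι₀ v)) (upper v))
        ; left = λ s<j → trans (ε₀-ι₀ _) (left s<j) ; right = λ j′<s → trans (ε₀-ι₀ _) (right j′<s) }
        where
        open Match M
        ι₀ : Fin size → Fin m
        ι₀ v = proj₁ (convex (lower v) (upper v))
        h-ι₀ : ∀ v → h (ι₀ v) ≡ ι v
        h-ι₀ v = proj₂ (convex (lower v) (upper v))
        ε₀-ι₀ : ∀ v → ε₀ (ι₀ v) ≡ ε (ι v)
        ε₀-ι₀ v = trans (sym (ε≗ (ι₀ v))) (cong ε (h-ι₀ v))

      -- The image of `h` is an interval, so an arc and its image have the same word: neither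
      -- `Follows` nor `Match` can tell them apart.
      restrict-⊑ : {x x′ : Perm n} {u u′ : Perm m} →
        (∀ ε₀ → ∃ λ ε → ∀ s → ε (h s) ≡ ε₀ s) →
        (∀ {s t} → pos u s < pos u t → pos x (h s) < pos x (h t)) →
        (∀ {s t} → pos x′ (h s) < pos x′ (h t) → pos u′ s < pos u′ t) →
        x ⊑ x′ → u ⊑ u′
      restrict-⊑ {x} {x′} {u} {u′} extend u⇒x x′⇒u′ x⊑x′ ε₀ a b F = let ε , ε≗ = extend ε₀ in
        Sum.map (λ F′ {e} {f} adm → x′⇒u′ (F′ (admissible-image true {ε} (relabel ε ε≗ adm))))
          (match-preimage ε≗) (x⊑x′ ε (h a) (h b) (Fx ε ε≗))
        where
        relabel : ∀ ε (ε≗ : ∀ s → ε (h s) ≡ ε₀ s) {e f} →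
          Admissible true ε₀ a b e f → Admissible true (ε ∘ h) a b e f
        relabel ε ε≗ (a≤e , e<f , f≤b , e-label , f-label) =
          a≤e , e<f , f≤b , Sum.map₂ (trans (ε≗ _)) e-label , Sum.map₂ (trans (ε≗ _)) f-label

        Fx : ∀ ε (ε≗ : ∀ s → ε (h s) ≡ ε₀ s) → Follows true ε (h a) (h b) x
        Fx ε ε≗ {e} {f} (a≤e , e<f , f≤b , e-label , f-label)
          with convex a≤e (ℕₚ.≤-trans (ℕₚ.<⇒≤ e<f) f≤b) | convex (ℕₚ.≤-trans a≤e (ℕₚ.<⇒≤ e<f)) f≤b
        ... | s , refl | t , refl = u⇒x (F (increasing-cancel-≤ h↑ a≤e , increasing-cancel h↑ e<f , increasing-cancel-≤ h↑ f≤b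
            , Sum.map (increasing-injective h↑) (trans (sym (ε≗ s))) e-label
            , Sum.map (increasing-injective h↑) (trans (sym (ε≗ t))) f-label))

  record Embedded (x x′ : Perm n) (e f : Fin n) : Set where
    field
      {width} : ℕ
      {u u′}  : Perm width
      u⊑u′    : u ⊑ u′
      h       : Fin width → Fin n
      h↑      : Increasing h
      x⇒u     : ∀ {s t} → pos x (h s) < pos x (h t) → pos u s < pos u t
      u′⇒x′   : ∀ {s t} → pos u′ s < pos u′ t → pos x′ (h s) < pos x′ (h t)
      e₀ f₀   : Fin width
      h-e₀    : h e₀ ≡ e
      h-f₀    : h f₀ ≡ f

  -- Each inversion is treated separately. The subarc from `e` to `f`, thinned out to the image of
  -- `h`, is followed by `u`. Either `u′` follows it too and `x′` has the inversion, or its word has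
  -- a match; a subword of the thinned word is one of the full word, so `h` may skip values.
  patch-⊑ : (x x′ : Perm n) →
    (∀ {e f} → Inverted x e f → Inverted x′ e f ⊎ Embedded x x′ e f) → x ⊑ x′
  patch-⊑ x x′ cover ε a b F = Sum.map₁ (λ G {e} {f} → G e f) (distribute₂ step)
    where
    step : ∀ e f → (Admissible true ε a b e f → Ordered true x′ e f) ⊎ Match ε a b
    step e f with admissible? true ε a b e f
    ... | no ¬adm = inj₁ λ adm → contradiction adm ¬adm
    ... | yes adm@(a≤e , e<f , f≤b , e-label , f-label) with cover (e<f , F adm)
    ...   | inj₁ (_ , fe) = inj₁ λ _ → fe
    ...   | inj₂ record { u = u ; u′ = u′ ; u⊑u′ = u⊑u′ ; h = h ; h↑ = h↑ ; x⇒u = x⇒u ; u′⇒x′ = u′⇒x′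
                        ; e₀ = e₀ ; f₀ = f₀ ; h-e₀ = refl ; h-f₀ = refl } =
      Sum.map (λ F′ _ → u′⇒x′ (F′ {e₀} {f₀} (ℕₚ.≤-refl , increasing-cancel h↑ e<f , ℕₚ.≤-refl , inj₁ refl , inj₁ refl)))
        (match-mono a≤e f≤b ∘ match-image h↑) (u⊑u′ (ε ∘ h) e₀ f₀ Fu)
      where
      Fu : Follows true (ε ∘ h) e₀ f₀ u
      Fu {s} {t} (e₀≤s , s<t , t≤f₀ , s-label , t-label) = x⇒u (F
        ( ℕₚ.≤-trans a≤e (increasing-≤ h↑ e₀≤s) , h↑ s<t , ℕₚ.≤-trans (increasing-≤ h↑ t≤f₀) f≤b
        , Sum.[ (λ { refl → e-label }) , inj₂ ] s-label , Sum.[ (λ { refl → f-label }) , inj₂ ] t-label))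

  shuffle-⊑ : {α : Fin p → Fin n} {β : Fin q → Fin n} → Increasing α → Increasing β →
    (∀ c → (∃ λ s → α s ≡ c) ⊎ (∃ λ t → β t ≡ c)) →
    {u u′ : Perm p} {v v′ : Perm q} {x x′ : Perm n} →
    Shuffle α β u v x → Shuffle α β u′ v′ x′ → u ⊑ u′ → v ⊑ v′ → x ⊑ x′
  shuffle-⊑ {α = α} {β} α↑ β↑ onto {u} {u′} {v} {v′} {x} {x′} S S′ u⊑u′ v⊑v′ = patch-⊑ x x′ cover
    where
    module S = Shuffle S
    module S′ = Shuffle S′
    open Equivalence
    cover : ∀ {e f} → Inverted x e f → Inverted x′ e f ⊎ Embedded x x′ e f
    cover {e} {f} (e<f , fe) with onto e | onto f
    ... | inj₁ (s , s≡) | inj₁ (t , t≡) = inj₂ record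
      { u = u ; u′ = u′ ; u⊑u′ = u⊑u′ ; h = α ; h↑ = α↑ ; x⇒u = from S.left ; u′⇒x′ = to S′.left ; h-e₀ = s≡ ; h-f₀ = t≡ }
    ... | inj₂ (s , s≡) | inj₂ (t , t≡) = inj₂ record
      { u = v ; u′ = v′ ; u⊑u′ = v⊑v′ ; h = β ; h↑ = β↑ ; x⇒u = from S.right ; u′⇒x′ = to S′.right ; h-e₀ = s≡ ; h-f₀ = t≡ }
    ... | inj₁ (s , refl) | inj₂ (t , refl) = contradiction fe (ℕₚ.<-asym (S.across s t))
    ... | inj₂ (s , refl) | inj₁ (t , refl) = inj₁ (e<f , S′.across t s)

  Θ-shuffle : {α : Fin p → Fin n} {β : Fin q → Fin n} → Increasing α → Increasing β →
    (∀ c → (∃ λ s → α s ≡ c) ⊎ (∃ λ t → β t ≡ c)) →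
    {u u′ : Perm p} {v v′ : Perm q} {x x′ : Perm n} →
    Shuffle α β u v x → Shuffle α β u′ v′ x′ → Θ p u u′ → Θ q v v′ → Θ n x x′
  Θ-shuffle α↑ β↑ onto {u} {u′} {v} {v′} {x} {x′} S S′ (u⊑ , ⊒u) (v⊑ , ⊒v) =
    shuffle-⊑ α↑ β↑ onto {u} {u′} {v} {v′} {x} {x′} S S′ u⊑ v⊑ ,
    shuffle-⊑ α↑ β↑ onto {u′} {u} {v′} {v} {x′} {x} S′ S ⊒u ⊒v

  Θ-translational : Translational Θ
  Θ-translational {p} {q} u u′ v v′ = mk⇔
    (λ (xx′ , x′x) →
      (restrictˡ u u′ v v′ xx′ , restrictˡ u′ u v′ v x′x) ,
      (restrictʳ u u′ v v′ xx′ , restrictʳ u′ u v′ v x′x))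
    (λ (uu′ , vv′) → Θ-shuffle ↑ˡ-increasing ↑ʳ-increasing (split p)
      {u} {u′} {v} {v′} {u ⊗ v} {u′ ⊗ v′} (shuffle-⊗ u v) (shuffle-⊗ u′ v′) uu′ vv′)
    where
    open Equivalence
    restrictˡ : ∀ (u u′ : Perm p) (v v′ : Perm q) → u ⊗ v ⊑ u′ ⊗ v′ → u ⊑ u′
    restrictˡ u u′ v v′ = restrict-⊑ ↑ˡ-increasing (λ {a} {b} → ↑ˡ-convex {a = a} {b}) {u ⊗ v} {u′ ⊗ v′} {u} {u′}
      -- The label `true` outside the block is an arbitrary choice: an arc with both ends in the
      -- block stays inside it.
      (λ ε₀ → Sum.[ ε₀ , (λ _ → true) ] ∘ Fin.splitAt p , λ s → cong Sum.[ ε₀ , (λ _ → true) ] (Finₚ.splitAt-↑ˡ p s q))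
      (to (Shuffle.left (shuffle-⊗ u v))) (from (Shuffle.left (shuffle-⊗ u′ v′)))
    restrictʳ : ∀ (u u′ : Perm p) (v v′ : Perm q) → u ⊗ v ⊑ u′ ⊗ v′ → v ⊑ v′
    restrictʳ u u′ v v′ = restrict-⊑ ↑ʳ-increasing (λ {a} {b} → ↑ʳ-convex {a = a} {b}) {u ⊗ v} {u′ ⊗ v′} {v} {v′}
      (λ ε₀ → Sum.[ (λ _ → true) , ε₀ ] ∘ Fin.splitAt p , λ t → cong Sum.[ (λ _ → true) , ε₀ ] (Finₚ.splitAt-↑ʳ p q t))
      (to (Shuffle.right (shuffle-⊗ u v))) (from (Shuffle.right (shuffle-⊗ u′ v′)))

  Θ-insertional : Insertional Θ
  Θ-insertional Q _ {u} {u′} {v} {v′} {x} {x′} I I′ = Θ-shuffle I.α↑ I.β↑ I.onto {u} {u′} {v} {v′} {x} {x′}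
    (I.insertion-shuffle (λ _ → refl) (λ _ → refl))
    (I′.insertion-shuffle
      (increasing-unique I.α↑ I′.α↑ λ t → I′.Q⊆α (I.α∈Q t))
      (increasing-unique I.β↑ I′.β↑ λ t → I′.∉Q⊆β (I.β∉Q t)))
    where
    module I = Insertion I
    module I′ = Insertion I′

  Θ-isHFamily : IsHFamily Θ
  Θ-isHFamily = record
    { isCongruence = Θ-isCongruence ; translational = Θ-translational ; insertional = Θ-insertional }

-- Untranslated join-irreducibles

descent⇒inverted : (x : Perm n) {i i′ : Fin n} → Descent x i i′ → Inverted x (x ⟨$⟩ʳ i′) (x ⟨$⟩ʳ i)
descent⇒inverted x (adj , xi′<xi) = xi′<xi , subst₂ _<_ (sym (inverseˡ x)) (sym (inverseˡ x)) (adjacent⇒< adj)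

descent-empty : (x : Perm n) {i i′ : Fin n} → Descent x i i′ →
  ∀ e → pos x (x ⟨$⟩ʳ i) < pos x e → ¬ (pos x e < pos x (x ⟨$⟩ʳ i′))
descent-empty x (adj , _) e i<e e<i′ =
  adjacent⇒empty adj (subst (_< pos x e) (inverseˡ x) i<e) (subst (pos x e <_) (inverseˡ x) e<i′)

uncover-descent : (x : Perm n) {i i′ : Fin n} → Descent x i i′ → ∃ λ y → Edge x y (x ⟨$⟩ʳ i′) (x ⟨$⟩ʳ i)
uncover-descent x d = uncover x (descent⇒inverted x d) (descent-empty x d)

module Cliffs (γ : Perm k) (ji : JoinIrreducible γ) (ut : Untranslated γ)
              {j j′ : Fin k} (d : Descent γ j j′) where

  adjacent : Adjacent j j′
  adjacent = proj₁ d

  only-descent : ∀ {i i′} → Descent γ i i′ → i ≡ j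
  only-descent {i} {i′} d′ = trans (sym (unique (i′ , d′))) (unique (j′ , d))
    where unique = λ {i} → proj₂ (proj₂ ji) {i}

  private
    step : ∀ {i i′} → Adjacent i i′ → i ≢ j → γ ⟨$⟩ʳ i < γ ⟨$⟩ʳ i′
    step adj i≢j = ≮∧≢⇒> (λ lt → i≢j (only-descent (adj , lt)))
      (λ eq → Finₚ.<⇒≢ (adjacent⇒< adj) (sym (value-injective γ eq)))

  left-run : ∀ {s t : Fin k} → s < t → t Fin.≤ j → γ ⟨$⟩ʳ s < γ ⟨$⟩ʳ t
  left-run s<t = steps⇒increasing 0 (toℕ j)
    (λ adj _ i′≤j → step adj (Finₚ.<⇒≢ (ℕₚ.<-≤-trans (adjacent⇒< adj) i′≤j))) s<t z≤n

  right-run : ∀ {s t : Fin k} → s < t → j′ Fin.≤ s → γ ⟨$⟩ʳ s < γ ⟨$⟩ʳ t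
  right-run s<t j′≤s = steps⇒increasing (toℕ j′) k
    (λ adj j′≤i _ → step adj (≢-sym (Finₚ.<⇒≢ (ℕₚ.<-≤-trans (adjacent⇒< adjacent) j′≤i)))) s<t j′≤s (Finₚ.toℕ≤n _)

  side : ∀ (s : Fin k) → s Fin.≤ j ⊎ j′ Fin.≤ s
  side s with s Finₚ.≤? j
  ... | yes s≤j = inj₁ s≤j
  ... | no  s≰j = inj₂ (subst (ℕ._≤ toℕ s) (sym adjacent) (ℕₚ.≰⇒> s≰j))

  top bot : Fin k
  top = γ ⟨$⟩ʳ j
  bot = γ ⟨$⟩ʳ j′

  -- The smallest value must start one of the two increasing runs. Being untranslated excludes the
  -- first position, so it stands at `j′`; dually the largest value stands at `j`.
  cliff : Cliff γ j j′
  cliff = adjacent , go γ ut left-run right-run side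
    where
    -- `Untranslated` reduces only at a successor, so the situation is restated for a size that can
    -- be split.
    go : ∀ {k} (γ : Perm k) → Untranslated γ → {j j′ : Fin k} →
      (∀ {s t : Fin k} → s < t → t Fin.≤ j → γ ⟨$⟩ʳ s < γ ⟨$⟩ʳ t) →
      (∀ {s t : Fin k} → s < t → j′ Fin.≤ s → γ ⟨$⟩ʳ s < γ ⟨$⟩ʳ t) →
      (∀ (s : Fin k) → s Fin.≤ j ⊎ j′ Fin.≤ s) →
      suc (toℕ (γ ⟨$⟩ʳ j)) ≡ k × toℕ (γ ⟨$⟩ʳ j′) ≡ 0
    go {suc m} γ (0<γ0 , γm<m) {j} {j′} left-run right-run side = cong suc top≡ , bot≡
      where
      γp : ∀ {v} → γ ⟨$⟩ʳ pos γ v ≡ v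
      γp = inverseʳ γ

      no-less : ∀ {s : Fin (suc m)} → ¬ (γ ⟨$⟩ʳ s < γ ⟨$⟩ʳ pos γ zero)
      no-less {s} lt = contradiction (subst (γ ⟨$⟩ʳ s <_) γp lt) λ ()

      no-more : ∀ {s : Fin (suc m)} → ¬ (γ ⟨$⟩ʳ pos γ (fromℕ m) < γ ⟨$⟩ʳ s)
      no-more {s} lt = ℕₚ.<⇒≱ (subst (_< γ ⟨$⟩ʳ s) γp lt) (Finₚ.≤fromℕ (γ ⟨$⟩ʳ s))

      bot≡ : toℕ (γ ⟨$⟩ʳ j′) ≡ 0
      bot≡ with side (pos γ zero)
      ... | inj₁ p≤j with ≤⇒<∨≡ {i = zero {m}} {pos γ zero} z≤n
      ...   | inj₁ 0<p = contradiction (left-run 0<p p≤j) no-less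
      ...   | inj₂ 0≡p = contradiction (subst (zero {m} <_) (trans (cong (γ ⟨$⟩ʳ_) 0≡p) γp) 0<γ0) λ ()
      bot≡ | inj₂ j′≤p with ≤⇒<∨≡ j′≤p
      ...   | inj₁ j′<p = contradiction (right-run j′<p ℕₚ.≤-refl) no-less
      ...   | inj₂ j′≡p = cong toℕ (trans (cong (γ ⟨$⟩ʳ_) j′≡p) γp)

      top≡ : toℕ (γ ⟨$⟩ʳ j) ≡ m
      top≡ with side (pos γ (fromℕ m))
      ... | inj₂ j′≤p with ≤⇒<∨≡ (Finₚ.≤fromℕ (pos γ (fromℕ m)))
      ...   | inj₁ p<m = contradiction (right-run p<m j′≤p) no-more
      ...   | inj₂ p≡m = contradiction (subst (_< fromℕ m) (trans (cong (γ ⟨$⟩ʳ_) (sym p≡m)) γp) γm<m) (ℕₚ.<-irrefl refl)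
      top≡ | inj₁ p≤j with ≤⇒<∨≡ p≤j
      ...   | inj₁ p<j = contradiction (left-run p<j ℕₚ.≤-refl) no-more
      ...   | inj₂ p≡j = trans (cong toℕ (trans (cong (γ ⟨$⟩ʳ_) (sym p≡j)) γp)) (Finₚ.toℕ-fromℕ m)

  bot-least : ∀ (v : Fin k) → bot Fin.≤ v
  bot-least v = subst (ℕ._≤ toℕ v) (sym (proj₂ (proj₂ cliff))) z≤n

  top-greatest : ∀ (v : Fin k) → v Fin.≤ top
  top-greatest v = ℕₚ.≤-pred (subst (toℕ v ℕ.<_) (sym (proj₁ (proj₂ cliff))) (Finₚ.toℕ<n v))

  γ⋆ : Perm k
  γ⋆ = proj₁ (uncover-descent γ d)

  γ⋆-edge : Edge γ γ⋆ bot top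
  γ⋆-edge = proj₂ (uncover-descent γ d)

  inverted⇒sides : ∀ {a b} → Inverted γ a b → pos γ b Fin.≤ j × j′ Fin.≤ pos γ a
  inverted⇒sides {a} {b} (a<b , b<a) with side (pos γ b) | side (pos γ a)
  ... | inj₂ j′≤b | _ = contradiction (subst₂ _<_ (inverseʳ γ) (inverseʳ γ) (right-run b<a j′≤b)) (ℕₚ.<-asym a<b)
  ... | inj₁ _ | inj₁ a≤j = contradiction (subst₂ _<_ (inverseʳ γ) (inverseʳ γ) (left-run b<a a≤j)) (ℕₚ.<-asym a<b)
  ... | inj₁ b≤j | inj₂ j′≤a = b≤j , j′≤a

  -- If `y` kept the cliff inverted, then the increasing runs, which persist in `y ≤ γ`, would force
  -- all inversions of `γ` on `y`. Hence `y` lies below `γ⋆`, and the cover property makes their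
  -- inversions agree.
  cover-edge : ∀ {y} → y ⋖ γ → Edge γ y bot top
  cover-edge {y} (y≤γ , γ≰y , between) = record
    { inverted = descent⇒inverted γ d
    ; removed  = λ inv → γ≰y (λ {a} {b} → inverted⇒≤ inv {a} {b})
    ; below    = y≤γ
    ; rest     = λ inv → Sum.map₁ γ⋆≤y (rest inv)
    }
    where
    open Edge γ⋆-edge

    kept : ∀ {c e} → c < e → pos γ c < pos γ e → pos y c < pos y e
    kept c<e ce with pos-connex y (Finₚ.<⇒≢ c<e)
    ... | inj₁ lt = lt
    ... | inj₂ gt = contradiction (proj₂ (y≤γ (c<e , gt))) (ℕₚ.<-asym ce)

    inverted⇒≤ : Inverted y bot top → γ ≤ y
    inverted⇒≤ (_ , top<bot) {a} {b} inv@(a<b , _) = a<b , ℕₚ.≤-<-trans b≤top (ℕₚ.<-≤-trans top<bot bot≤a)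
      where
      b≤top : pos y b Fin.≤ pos y top
      b≤top with ≤⇒<∨≡ {i = b} {top} (top-greatest b)
      ... | inj₂ b≡top = ℕₚ.≤-reflexive (cong (toℕ ∘ pos y) b≡top)
      ... | inj₁ b<top = ℕₚ.<⇒≤ (kept b<top (ℕₚ.≤∧≢⇒< (subst (pos γ b Fin.≤_) (sym (inverseˡ γ)) (proj₁ (inverted⇒sides inv)))
              λ eq → Finₚ.<⇒≢ b<top (pos-injective γ (Finₚ.toℕ-injective eq))))
      bot≤a : pos y bot Fin.≤ pos y a
      bot≤a with ≤⇒<∨≡ {i = bot} {a} (bot-least a)
      ... | inj₂ bot≡a = ℕₚ.≤-reflexive (cong (toℕ ∘ pos y) bot≡a)
      ... | inj₁ bot<a = ℕₚ.<⇒≤ (kept bot<a (ℕₚ.≤∧≢⇒< (subst (Fin._≤ pos γ a) (sym (inverseˡ γ)) (proj₂ (inverted⇒sides inv)))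
              λ eq → Finₚ.<⇒≢ bot<a (pos-injective γ (Finₚ.toℕ-injective eq))))

    y≤γ⋆ : y ≤ γ⋆
    y≤γ⋆ inv with rest (y≤γ inv)
    ... | inj₁ inv⋆ = inv⋆
    ... | inj₂ (refl , refl) = contradiction (λ {a} {b} → inverted⇒≤ inv {a} {b}) γ≰y

    γ⋆≤y : γ⋆ ≤ y
    γ⋆≤y with between γ⋆ y≤γ⋆ below
    ... | inj₁ ≤y = ≤y
    ... | inj₂ γ≤γ⋆ = contradiction (γ≤γ⋆ inverted) removed

-- Pigeonhole on the values in front of `i`. Used in both directions, it locates the cliff of a
-- scramble by the set of values in front of it.
prefix-≤ : (x y : Perm n) (i j : Fin n) → (∀ v → pos x v < i → pos y v < j) → i Fin.≤ j
prefix-≤ x y i j sub = Finₚ.injective⇒≤ f-injective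
  where
  value : Fin (toℕ i) → Fin _
  value t = x ⟨$⟩ʳ Fin.inject t

  below-j : ∀ t → pos y (value t) < j
  below-j t = sub (value t) (subst₂ ℕ._<_ (sym (trans (cong toℕ (inverseˡ x)) (Finₚ.toℕ-inject t))) refl (Finₚ.toℕ<n t))

  f : Fin (toℕ i) → Fin (toℕ j)
  f t = fromℕ< (below-j t)

  f-injective : Injective _≡_ _≡_ f
  f-injective {s} {t} eq = Finₚ.toℕ-injective (trans (sym (Finₚ.toℕ-inject s)) (trans
    (cong toℕ (value-injective x (pos-injective y (Finₚ.toℕ-injective (Finₚ.fromℕ<-injective _ _ (below-j s) (below-j t) eq)))))
    (Finₚ.toℕ-inject t)))

-- Reading an arc off a descent

does⇒ : {A : Set} (a? : Dec A) → does a? ≡ true → A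
does⇒ (yes a) _ = a

¬does⇒ : {A : Set} (a? : Dec A) → does a? ≡ false → ¬ A
¬does⇒ (no ¬a) _ = ¬a

before : Perm n → Fin n → Label n
before x b v = does (pos x v Finₚ.<? pos x b)

-- In an admissible pair, `f` stands at or in front of `b`, and `e` behind `b`.
before-follows : (x : Perm n) {a b : Fin n} → Inverted x a b →
  (∀ e → pos x b < pos x e → ¬ (pos x e < pos x a)) → Follows true (before x b) a b x
before-follows x {a} {b} (_ , ba) empty {e} {f} (a≤e , e<f , f≤b , e-label , f-label) = ℕₚ.≤-<-trans f≤ <e
  where
  f≤ : pos x f Fin.≤ pos x b
  f≤ = Sum.[ (λ f≡b → ℕₚ.≤-reflexive (cong (toℕ ∘ pos x) f≡b)) , ℕₚ.<⇒≤ ∘ does⇒ (pos x f Finₚ.<? pos x b) ] f-label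

  <e : pos x b < pos x e
  <e = Sum.[ (λ e≡a → subst (pos x b <_) (cong (pos x) (sym e≡a)) ba)
           , (λ εe → ≮∧≢⇒> (¬does⇒ (pos x e Finₚ.<? pos x b) εe)
                (λ eq → ℕₚ.<⇒≱ e<f (subst (f Fin.≤_) (sym (pos-injective x eq)) f≤b))) ] e-label

-- Contractions of the arc congruences

module Contraction (C : PermSet) (C⊆ : ∀ {k} (γ : Perm k) → C k γ → JoinIrreducible γ × Untranslated γ) where

  open ArcCongruence C

  Θ-contracts : ContractsAll C Θ
  Θ-contracts {k} γ γ∈C with C⊆ γ γ∈C
  ... | ji@(j , (j′ , d) , _) , ut =
    γ⋆ , edge⇒⋖ γ⋆-edge , γ⊑γ⋆ , (λ ε a b F → inj₁ (λ {_} {_} → follows-mono {x = γ⋆} {γ} below F))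
    where
    open Cliffs γ ji ut d
    open Edge γ⋆-edge

    γ⊑γ⋆ : γ ⊑ γ⋆
    γ⊑γ⋆ ε a b F = Sum.map₁ (λ G {e} {f} → G e f) (distribute₂ step)
      where
      step : ∀ e f → (Admissible true ε a b e f → Ordered true γ⋆ e f) ⊎ Match ε a b
      step e f with admissible? true ε a b e f
      ... | no ¬adm = inj₁ λ adm → contradiction adm ¬adm
      ... | yes adm@(a≤e , e<f , f≤b , e-label , f-label) with rest (e<f , F adm)
      ...   | inj₁ (_ , fe) = inj₁ λ _ → fe
      -- The pair is the cliff itself, and `γ` matches by the identity. A value left of the cliff
      -- labelled `false` would be admissible with `top`, so `top` would precede it in `γ`; the
      -- right side is dual, with `bot`.
      ...   | inj₂ (refl , refl) = inj₂ record
        { γ = γ ; γ∈C = γ∈C ; descent = d ; ι = λ v → v ; ι↑ = λ lt → lt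
        ; lower = λ v → ℕₚ.≤-trans a≤e (bot-least v) ; upper = λ v → ℕₚ.≤-trans (top-greatest v) f≤b
        ; left = λ {s} s<j → Boolₚ.¬-not λ εs → ℕₚ.<-asym s<j
            (subst₂ _<_ (inverseˡ γ) (inverseˡ γ) (F
              ( ℕₚ.≤-trans a≤e (bot-least _)
              , ℕₚ.≤∧≢⇒< (top-greatest _) (λ eq → Finₚ.<⇒≢ s<j (value-injective γ (Finₚ.toℕ-injective eq)))
              , f≤b , inj₂ εs , f-label)))
        ; right = λ {s} j′<s → Boolₚ.¬-not λ εs → ℕₚ.<-asym j′<s
            (subst₂ _<_ (inverseˡ γ) (inverseˡ γ) (F
              ( a≤e
              , ℕₚ.≤∧≢⇒< (bot-least _) (λ eq → Finₚ.<⇒≢ j′<s (value-injective γ (Finₚ.toℕ-injective eq)))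
              , ℕₚ.≤-trans (top-greatest _) f≤b , e-label , inj₂ εs)))
        }

  module Standardization {ε : Label n} {a b : Fin n} (a<b : a < b) (M : Match ε a b) where
    open Match M
    open Cliffs γ (proj₁ (C⊆ γ γ∈C)) (proj₂ (C⊆ γ γ∈C)) descent

    bot<top : bot < top
    bot<top = proj₂ descent

    -- Stretching the ends of the match to `a` and `b` puts the cliff of the pattern on the descent
    -- of `x`.
    κ : Fin size → Fin n
    κ v with v Finₚ.≟ bot | v Finₚ.≟ top
    ... | yes _ | _     = a
    ... | no _  | yes _ = b
    ... | no _  | no _  = ι v

    κ-bot : κ bot ≡ a
    κ-bot with bot Finₚ.≟ bot
    ... | yes _ = refl
    ... | no ≢  = contradiction refl ≢

    κ-top : κ top ≡ b
    κ-top with top Finₚ.≟ bot | top Finₚ.≟ top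
    ... | yes eq | _     = contradiction (sym eq) (Finₚ.<⇒≢ bot<top)
    ... | no _   | yes _ = refl
    ... | no _   | no ≢  = contradiction refl ≢

    κ-inner : ∀ {v} → v ≢ bot → v ≢ top → κ v ≡ ι v
    κ-inner {v} v≢bot v≢top with v Finₚ.≟ bot | v Finₚ.≟ top
    ... | yes eq | _      = contradiction eq v≢bot
    ... | no _   | yes eq = contradiction eq v≢top
    ... | no _   | no _   = refl

    κ↑ : Increasing κ
    κ↑ {v} {w} v<w with v Finₚ.≟ bot | v Finₚ.≟ top | w Finₚ.≟ bot | w Finₚ.≟ top
    ... | _        | _        | yes refl | _        = contradiction (bot-least v) (ℕₚ.<⇒≱ v<w)
    ... | _        | yes refl | _        | _        = contradiction (top-greatest w) (ℕₚ.<⇒≱ v<w)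
    ... | yes refl | no _     | no _     | yes refl = a<b
    ... | yes refl | no _     | no _     | no _     = ℕₚ.≤-<-trans (lower v) (ι↑ v<w)
    ... | no _     | no _     | no _     | yes refl = ℕₚ.<-≤-trans (ι↑ v<w) (upper w)
    ... | no _     | no _     | no _     | no _     = ι↑ v<w

  Occurs : Perm n → Set
  Occurs x = ∃₂ λ k (γ : Perm k) → C k γ × ∃ λ (σ : Perm k) → Scramble γ σ × OccursWithAdjacentCliff σ x

  module _ (x : Perm n) {i i′ : Fin n} (d : Descent x i i′) where

    private
      a = x ⟨$⟩ʳ i′
      b = x ⟨$⟩ʳ i
      posa : pos x a ≡ i′
      posa = inverseˡ x
      posb : pos x b ≡ i
      posb = inverseˡ x

    descent-follows : Follows true (before x b) a b x
    descent-follows = before-follows x (descent⇒inverted x d) (descent-empty x d)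

    match⇒occurs : Match (before x b) a b → Occurs x
    match⇒occurs M = size , γ , γ∈C , σ ,
      (j , j′ , descent , cliff-σ , λ v → mk⇔
        (λ { (s , s<j , refl) → γ ⟨$⟩ˡ (σ ⟨$⟩ʳ s) , σ⇒γ _ (subst (_< j) (sym (inverseˡ σ)) s<j) , inverseʳ γ })
        (λ { (s , s<j , refl) → σ ⟨$⟩ˡ (γ ⟨$⟩ʳ s) , γ⇒σ _ (subst (_< j) (sym (inverseˡ γ)) s<j) , inverseʳ σ })) ,
      (j , j′ , cliff-σ , positions , positions↑ , (λ s t → mk⇔
        (λ lt → increasing-cancel κ↑ (subst₂ _<_ (inverseʳ x) (inverseʳ x) lt))
        (λ lt → subst₂ _<_ (sym (inverseʳ x)) (sym (inverseʳ x)) (κ↑ lt))) ,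
        subst₂ Adjacent (sym (trans (cong (pos x ∘ κ) σj) pos-top)) (sym (trans (cong (pos x ∘ κ) σj′) pos-bot)) (proj₁ d))
      where
      open Match M
      open Cliffs γ (proj₁ (C⊆ γ γ∈C)) (proj₂ (C⊆ γ γ∈C)) descent
      open Standardization (proj₂ d) M

      key : Fin size → ℕ
      key v = toℕ (pos x (κ v))

      key-injective : Injective _≡_ _≡_ key
      key-injective eq = increasing-injective κ↑ (pos-injective x (Finₚ.toℕ-injective eq))

      -- The pattern formed in `x` by the values `κ v`.
      σ : Perm size
      σ = proj₁ (sortBy key key-injective)

      σ-sorted : SortedBy key σ
      σ-sorted = proj₂ (sortBy key key-injective)

      positions : Fin size → Fin n
      positions s = pos x (κ (σ ⟨$⟩ʳ s))

      positions↑ : Increasing positions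
      positions↑ s<t = sorted-cancel key-injective σ σ-sorted (subst₂ _<_ (sym (inverseˡ σ)) (sym (inverseˡ σ)) s<t)

      pos-top : pos x (κ top) ≡ i
      pos-top = trans (cong (pos x) κ-top) posb

      pos-bot : pos x (κ bot) ≡ i′
      pos-bot = trans (cong (pos x) κ-bot) posa

      adjacent-σ : Adjacent (pos σ top) (pos σ bot)
      adjacent-σ = empty⇒adjacent
        (σ-sorted (subst₂ _<_ (sym pos-top) (sym pos-bot) (adjacent⇒< (proj₁ d))))
        λ l top<l l<bot → adjacent⇒empty (proj₁ d)
          (subst (_< positions l) (trans (cong (pos x ∘ κ) (inverseʳ σ)) pos-top) (positions↑ top<l))
          (subst (positions l <_) (trans (cong (pos x ∘ κ) (inverseʳ σ)) pos-bot) (positions↑ l<bot))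

      γ⇒top : ∀ v → pos γ v < j → pos σ v < pos σ top
      γ⇒top v v<j = σ-sorted (subst₂ _<_ (cong (pos x) (sym (κ-inner v≢bot v≢top))) (sym pos-top)
        (subst (pos x (ι v) <_) posb (does⇒ (pos x (ι v) Finₚ.<? pos x b)
          (subst (λ w → before x b (ι w) ≡ true) (inverseʳ γ) (left v<j)))))
        where
        v≢top : v ≢ top
        v≢top refl = ℕₚ.<-irrefl (cong toℕ (inverseˡ γ)) v<j
        v≢bot : v ≢ bot
        v≢bot refl = ℕₚ.<-asym (adjacent⇒< adjacent) (subst (_< j) (inverseˡ γ) v<j)

      top⇒γ : ∀ v → pos σ v < pos σ top → pos γ v < j
      top⇒γ v v<top with side (pos γ v)
      ... | inj₁ v≤j = ℕₚ.≤∧≢⇒< v≤j λ eq → ℕₚ.<-irrefl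
        (cong (toℕ ∘ pos σ) (trans (sym (inverseʳ γ)) (cong (γ ⟨$⟩ʳ_) (Finₚ.toℕ-injective eq)))) v<top
      ... | inj₂ j′≤v with ≤⇒<∨≡ j′≤v
      ...   | inj₂ j′≡v = contradiction
        (subst (λ w → pos σ w < pos σ top) (trans (sym (inverseʳ γ)) (cong (γ ⟨$⟩ʳ_) (sym j′≡v))) v<top)
        (ℕₚ.<-asym (adjacent⇒< adjacent-σ))
      ...   | inj₁ j′<v = contradiction
        (subst₂ _<_ (cong (pos x) (κ-inner v≢bot v≢top)) (cong (pos x) κ-top) (sorted-cancel key-injective σ σ-sorted v<top))
        (¬does⇒ (pos x (ι v) Finₚ.<? pos x b) (subst (λ w → before x b (ι w) ≡ false) (inverseʳ γ) (right j′<v)))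
        where
        v≢bot : v ≢ bot
        v≢bot refl = ℕₚ.<-irrefl (cong toℕ (sym (inverseˡ γ))) j′<v
        v≢top : v ≢ top
        v≢top refl = ℕₚ.<-irrefl refl v<top

      -- Both sides count the values in front of the cliff, and these are the same in `γ` and `σ`.
      j≡ : j ≡ pos σ top
      j≡ = Finₚ.toℕ-injective (ℕₚ.≤-antisym (prefix-≤ γ σ j (pos σ top) γ⇒top) (prefix-≤ σ γ (pos σ top) j top⇒γ))

      j′≡ : j′ ≡ pos σ bot
      j′≡ = Finₚ.toℕ-injective (trans adjacent (trans (cong (suc ∘ toℕ) j≡) (sym adjacent-σ)))

      σj : σ ⟨$⟩ʳ j ≡ top
      σj = trans (cong (σ ⟨$⟩ʳ_) j≡) (inverseʳ σ)

      σj′ : σ ⟨$⟩ʳ j′ ≡ bot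
      σj′ = trans (cong (σ ⟨$⟩ʳ_) j′≡) (inverseʳ σ)

      cliff-σ : Cliff σ j j′
      cliff-σ = adjacent , trans (cong (suc ∘ toℕ) σj) (proj₁ (proj₂ cliff)) , trans (cong toℕ σj′) (proj₂ (proj₂ cliff))

      γ⇒σ : ∀ v → pos γ v < j → pos σ v < j
      γ⇒σ v = subst (pos σ v <_) (sym j≡) ∘ γ⇒top v

      σ⇒γ : ∀ v → pos σ v < j → pos γ v < j
      σ⇒γ v = top⇒γ v ∘ subst (pos σ v <_) j≡

  -- If all descents of `x` remained inverted in `y`, consecutive entries of `x` would keep their
  -- order in `y`, its ascents because of `y ≤ x`. Then the positions in `y` would increase along
  -- `x`, giving `x ≤ y`.
  fallen-descent : {x y : Perm n} → y ≤ x → ¬ (x ≤ y) →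
    ∃₂ λ i i′ → Descent x i i′ × ¬ Inverted y (x ⟨$⟩ʳ i′) (x ⟨$⟩ʳ i)
  fallen-descent {n} {x} {y} y≤x x≰y = Sum.[ (λ steps → contradiction (λ {a} {b} → x≤y steps {a} {b}) x≰y) , (λ found → found) ]
    (distribute₂ step)
    where
    Fallen : Set
    Fallen = ∃₂ λ i i′ → Descent x i i′ × ¬ Inverted y (x ⟨$⟩ʳ i′) (x ⟨$⟩ʳ i)

    Step : Rel (Fin n) 0ℓ
    Step i i′ = Adjacent i i′ → pos y (x ⟨$⟩ʳ i) < pos y (x ⟨$⟩ʳ i′)

    step : ∀ i i′ → Step i i′ ⊎ Fallen
    step i i′ with toℕ i′ ℕₚ.≟ suc (toℕ i)
    ... | no ¬adj = inj₁ λ adj → contradiction adj ¬adj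
    ... | yes adj with inverted? y (x ⟨$⟩ʳ i′) (x ⟨$⟩ʳ i) | (x ⟨$⟩ʳ i′) Finₚ.<? (x ⟨$⟩ʳ i)
    ...   | yes (_ , lt) | _ = inj₁ λ _ → lt
    ...   | no ¬inv | yes fall = inj₂ (i , i′ , (adj , fall) , ¬inv)
    ...   | no ¬inv | no ¬fall = inj₁ λ _ → Sum.[ (λ lt → lt) , (λ gt → contradiction (y≤x (rise , gt))
              λ (_ , lt) → ℕₚ.<-asym (adjacent⇒< adj) (subst₂ _<_ (inverseˡ x) (inverseˡ x) lt)) ]
              (pos-connex y (Finₚ.<⇒≢ rise))
      where
      rise : x ⟨$⟩ʳ i < x ⟨$⟩ʳ i′
      rise = ≮∧≢⇒> ¬fall λ eq → Finₚ.<⇒≢ (adjacent⇒< adj) (sym (value-injective x eq))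

    x≤y : (∀ i i′ → Step i i′) → x ≤ y
    x≤y steps (a<b , b<a) = a<b , subst₂ _<_ (cong (pos y) (inverseʳ x)) (cong (pos y) (inverseʳ x))
      (steps⇒increasing {f = λ i → pos y (x ⟨$⟩ʳ i)} 0 n (λ {i} {i′} adj _ _ → steps i i′ adj) b<a z≤n (Finₚ.toℕ≤n _))

  contracts⇒occurs : {x : Perm n} → Contracts (Θ n) x → Occurs x
  contracts⇒occurs {x = x} (y , (y≤x , x≰y , _) , x⊑y , _) with fallen-descent {x = x} {y} y≤x x≰y
  -- `x` follows the arc of this descent but `y` does not, as it has lost the inversion of the two
  -- ends. So `x ⊑ y` can only supply a match.
  ... | i , i′ , d@(_ , fall) , ¬inv with x⊑y (before x (x ⟨$⟩ʳ i)) _ _ (descent-follows x d)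
  ...   | inj₂ M = match⇒occurs x d M
  ...   | inj₁ F = contradiction (fall , F (ℕₚ.≤-refl , fall , ℕₚ.≤-refl , inj₁ refl , inj₁ refl)) ¬inv

-- Transporting contractions

edge-mono : {g g′ x x′ : Perm n} {a b : Fin n} → g ≤ x → Edge g g′ a b → Edge x x′ a b → g′ ≤ x′
edge-mono g≤x E E′ inv with Edge.rest E′ (g≤x (Edge.below E inv))
... | inj₁ inv′ = inv′
... | inj₂ (refl , refl) = contradiction inv (Edge.removed E)

edge-transport : {x y : Perm n} {a b a′ b′ : Fin n} → a ≡ a′ → b ≡ b′ → Edge x y a b → Edge x y a′ b′
edge-transport refl refl E = E

module _ {Θ : Rel (Perm n) 0ℓ} (Θ-cong : IsCongruence Θ) where
  open IsCongruence Θ-cong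
  open IsEquivalence isEquivalence using () renaming (refl to Θ-refl)

  -- `x` is the join of `x′` and `g`, and `x′` is the join of `x′` and `g′`.
  edge-up : {g g′ x x′ : Perm n} {a b : Fin n} → g ≤ x → Edge g g′ a b → Edge x x′ a b → Θ g g′ → Θ x x′
  edge-up {g} {g′} {x} {x′} g≤x E E′ gg′ = join-cong (Θ-refl {x′}) gg′
    (record { left = Edge.below E′ ; right = g≤x
            ; least = λ w x′≤w g≤w inv → Sum.[ x′≤w , (λ { (refl , refl) → g≤w (Edge.inverted E) }) ] (Edge.rest E′ inv) })
    (record { left = λ inv → inv ; right = edge-mono {g = g} {g′} {x} {x′} g≤x E E′ ; least = λ _ x′≤w _ → x′≤w })

  -- `g` is the meet of `w` and `g`, and `g′` is the meet of `w′` and `g`.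
  edge-down : {g g′ w w′ : Perm n} {a b : Fin n} → g ≤ w → Edge g g′ a b → Edge w w′ a b → Θ w w′ → Θ g g′
  edge-down {g} {g′} {w} {w′} g≤w E E′ ww′ = meet-cong ww′ (Θ-refl {g})
    (record { left = g≤w ; right = λ inv → inv ; greatest = λ _ _ z≤g → z≤g })
    (record { left = edge-mono {g = g} {g′} {w} {w′} g≤w E E′ ; right = Edge.below E
            ; greatest = λ z z≤w′ z≤g inv → Sum.[ (λ inv′ → inv′)
                , (λ { (refl , refl) → contradiction (z≤w′ inv) (Edge.removed E′) }) ] (Edge.rest E (z≤g inv)) })

  -- Both edges are perspective to the edge below the join-irreducible of the arc.
  edge-transfer : ∀ (ε : Label n) {a b} {w w′ x x′ : Perm n} →
    Follows true ε a b w → Follows true ε a b x → Edge w w′ a b → Edge x x′ a b → Θ w w′ → Θ x x′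
  edge-transfer ε {a} {b} {w} {w′} {x} {x′} Fw Fx Ew Ex ww′ =
    edge-up {g = g} {x = x} (arc-≤ ε a<b {x} Fx) g-edge Ex
      (edge-down {g = g} {w = w} (arc-≤ ε a<b {w} Fw) g-edge Ew ww′)
    where
    a<b = proj₁ (Edge.inverted Ew)
    g = arcJoinIrreducible ε a<b
    g-edge = proj₂ (uncover g (a<b , arc-follows ε a<b (arc-ends ε a<b)) (arc-empty ε a<b))

-- Inserting a value at either end

module _ (r c : Fin (suc n)) where

  insert-order : (v : Perm n) {s t : Fin n} →
    pos v s < pos v t ⇔ pos (insert r c v) (punchIn c s) < pos (insert r c v) (punchIn c t)
  insert-order v {s} {t} = mk⇔
    (λ lt → subst₂ _<_ (sym (pos-insert-punchIn r c v s)) (sym (pos-insert-punchIn r c v t)) (punchIn-increasing r lt))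
    (λ lt → increasing-cancel (punchIn-increasing r) (subst₂ _<_ (pos-insert-punchIn r c v s) (pos-insert-punchIn r c v t) lt))

  Extreme : Set
  Extreme = (∀ (s : Fin n) → r < punchIn r s) ⊎ (∀ (s : Fin n) → punchIn r s < r)

  first⇒ : (v : Perm n) → (∀ s → r < punchIn r s) → ∀ t → pos (insert r c v) c < pos (insert r c v) (punchIn c t)
  first⇒ v first t = subst₂ _<_ (sym (pos-insert-self r c v)) (sym (pos-insert-punchIn r c v t)) (first (pos v t))

  last⇒ : (v : Perm n) → (∀ s → punchIn r s < r) → ∀ t → pos (insert r c v) (punchIn c t) < pos (insert r c v) c
  last⇒ v last t = subst₂ _<_ (sym (pos-insert-punchIn r c v t)) (sym (pos-insert-self r c v)) (last (pos v t))

  data View : Pred (Fin (suc n)) 0ℓ where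
    self  : View c
    other : ∀ s → View (punchIn c s)

  view : ∀ e → View e
  view e with c Finₚ.≟ e
  ... | yes refl = self
  ... | no c≢e = subst View (Finₚ.punchIn-punchOut c≢e) (other (punchOut c≢e))

  -- At the front or at the end, `c` compares with the other values in the same way whatever
  -- permutation receives it. So the insertion creates no further difference between the two ends of
  -- an edge.
  self-other : Extreme → (v v′ : Perm n) → ∀ t →
    pos (insert r c v) c < pos (insert r c v) (punchIn c t) → pos (insert r c v′) c < pos (insert r c v′) (punchIn c t)
  self-other (inj₁ first) v v′ t _  = first⇒ v′ first t
  self-other (inj₂ last)  v v′ t lt = contradiction lt (ℕₚ.<-asym (last⇒ v last t))

  other-self : Extreme → (v v′ : Perm n) → ∀ t →
    pos (insert r c v) (punchIn c t) < pos (insert r c v) c → pos (insert r c v′) (punchIn c t) < pos (insert r c v′) c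
  other-self (inj₁ first) v v′ t lt = contradiction lt (ℕₚ.<-asym (first⇒ v first t))
  other-self (inj₂ last)  v v′ t _  = last⇒ v′ last t

  edge-insert : Extreme → {v v′ : Perm n} {a b : Fin n} → Edge v v′ a b →
    Edge (insert r c v) (insert r c v′) (punchIn c a) (punchIn c b)
  edge-insert extreme {v} {v′} {a} {b} E = record
    { inverted = punchIn-increasing c (proj₁ inverted) , to (insert-order v) (proj₂ inverted)
    ; removed  = λ (lt , inv) → removed (increasing-cancel (punchIn-increasing c) lt , from (insert-order v′) inv)
    ; below    = λ {e} {f} → below′ (view e) (view f)
    ; rest     = λ {e} {f} → rest′ (view e) (view f)
    }
    where
    open Edge E
    open Equivalence
    w  = insert r c v
    w′ = insert r c v′

    below′ : ∀ {e f} → View e → View f → Inverted w′ e f → Inverted w e f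
    below′ self self (lt , _) = contradiction lt (ℕₚ.<-irrefl refl)
    below′ self (other t) (lt , inv) = lt , other-self extreme v′ v t inv
    below′ (other s) self (lt , inv) = lt , self-other extreme v′ v s inv
    below′ (other s) (other t) (lt , inv) = lt , to (insert-order v)
      (proj₂ (below (increasing-cancel (punchIn-increasing c) lt , from (insert-order v′) inv)))

    rest′ : ∀ {e f} → View e → View f → Inverted w e f → Inverted w′ e f ⊎ (e ≡ punchIn c a × f ≡ punchIn c b)
    rest′ self self (lt , _) = contradiction lt (ℕₚ.<-irrefl refl)
    rest′ self (other t) (lt , inv) = inj₁ (lt , other-self extreme v v′ t inv)
    rest′ (other s) self (lt , inv) = inj₁ (lt , self-other extreme v v′ s inv)
    rest′ (other s) (other t) (lt , inv) = Sum.map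
      (λ inv′ → lt , to (insert-order v′) (proj₂ inv′))
      (λ (s≡ , t≡) → cong (punchIn c) s≡ , cong (punchIn c) t≡)
      (rest (increasing-cancel (punchIn-increasing c) lt , from (insert-order v) inv))

¬⇔¬ : {A B : Set} → ¬ A → ¬ B → A ⇔ B
¬⇔¬ ¬a ¬b = mk⇔ (λ a → contradiction a ¬a) (λ b → contradiction b ¬b)

punchIn-last : (s : Fin n) → toℕ (punchIn (fromℕ n) s) ≡ toℕ s
punchIn-last zero    = refl
punchIn-last (suc s) = cong suc (punchIn-last s)

insert-std : (r c : Fin (suc n)) (v : Perm n) (s t : Fin n) →
  (v ⟨$⟩ʳ s < v ⟨$⟩ʳ t) ⇔ (insert r c v ⟨$⟩ʳ punchIn r s < insert r c v ⟨$⟩ʳ punchIn r t)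
insert-std r c v s t = mk⇔
  (λ lt → subst₂ _<_ (sym (insert-punchIn r c v s)) (sym (insert-punchIn r c v t)) (punchIn-increasing c lt))
  (λ lt → increasing-cancel (punchIn-increasing c) (subst₂ _<_ (insert-punchIn r c v s) (insert-punchIn r c v t) lt))

first-insertion : (c : Fin (suc n)) (v : Perm n) → IsInsertion {1} {n} ⁅ c ⁆ id v (insert zero c v)
first-insertion c v = record
  { prefix-set = λ a → mk⇔
      (λ a∈ → zero , trans (insert-self zero c v) (sym (Subsetₚ.x∈⁅y⁆⇒x≡y c a∈)))
      (λ { (zero , refl) → subst (_∈ ⁅ c ⁆) (sym (insert-self zero c v)) (Subsetₚ.x∈⁅x⁆ c) })
  ; prefix-std = λ { zero zero → ¬⇔¬ (ℕₚ.<-irrefl refl) (ℕₚ.<-irrefl refl) }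
  ; suffix-std = λ s t → insert-std zero c v s t
  }

last-insertion : (c : Fin (m ℕ.+ 1)) (v : Perm m) (w : Perm (m ℕ.+ 1)) →
  w ⟨$⟩ʳ (m ↑ʳ zero) ≡ c → (∀ s t → (v ⟨$⟩ʳ s < v ⟨$⟩ʳ t) ⇔ (w ⟨$⟩ʳ (s ↑ˡ 1) < w ⟨$⟩ʳ (t ↑ˡ 1))) →
  IsInsertion {m} {1} (∁ ⁅ c ⁆) v id w
last-insertion {m} c v w at-last std = record
  { prefix-set = λ a → mk⇔ (present a) λ { (i , refl) → Subsetₚ.x∉p⇒x∈∁p (Subsetₚ.x≢y⇒x∉⁅y⁆ λ eq →
      ℕₚ.<-irrefl (cong toℕ (value-injective w (trans eq (sym at-last)))) (↑ˡ<↑ʳ i (zero {0}))) }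
  ; prefix-std = std
  ; suffix-std = λ { zero zero → ¬⇔¬ (ℕₚ.<-irrefl refl) (ℕₚ.<-irrefl refl) }
  }
  where
  present : ∀ a → a ∈ ∁ ⁅ c ⁆ → ∃ λ (i : Fin m) → w ⟨$⟩ʳ (i ↑ˡ 1) ≡ a
  present a a∈ with split m (pos w a)
  ... | inj₁ (i , eq) = i , trans (cong (w ⟨$⟩ʳ_) eq) (inverseʳ w)
  ... | inj₂ (zero , eq) = contradiction
    (subst (_∈ ⁅ c ⁆) (trans (sym at-last) (trans (cong (w ⟨$⟩ʳ_) eq) (inverseʳ w))) (Subsetₚ.x∈⁅x⁆ c))
    (Subsetₚ.x∈∁p⇒x∉p a∈)

-- Contractions forced in every H-family

module HFamily {H : Family} (H-family : IsHFamily H) where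
  open IsHFamily H-family

  H-refl : ∀ {n} {x : Perm n} → H n x x
  H-refl {n} = IsEquivalence.refl (IsCongruence.isEquivalence (isCongruence n))

  insert-first : (c : Fin (suc n)) {v v′ : Perm n} → H n v v′ → H (suc n) (insert zero c v) (insert zero c v′)
  insert-first {n} c {v} {v′} = insertional {1} {n} ⁅ c ⁆ (Subsetₚ.∣⁅x⁆∣≡1 c)
    (first-insertion c v) (first-insertion c v′) H-refl

  insert-last : (c : Fin (suc m)) {v v′ : Perm m} → H m v v′ →
    H (suc m) (insert (fromℕ m) c v) (insert (fromℕ m) c v′)
  insert-last {m} c {v} {v′} = general (ℕₚ.+-comm m 1) c _ _
    (punchIn (fromℕ m)) punchIn-last (fromℕ m) (Finₚ.toℕ-fromℕ m)
    (insert-self (fromℕ m) c v) (insert-self (fromℕ m) c v′) (insert-std (fromℕ m) c v) (insert-std (fromℕ m) c v′)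
    where
    -- An insertion at the end has size `m + 1`, while `insert` yields size `suc m`. All data of
    -- that size become variables, with positions pinned down by `toℕ`, so that the equation can be
    -- matched with `refl`.
    general : ∀ {n} → m ℕ.+ 1 ≡ n → (c : Fin n) (w w′ : Perm n) →
      (f : Fin m → Fin n) → (∀ s → toℕ (f s) ≡ toℕ s) → (l : Fin n) → toℕ l ≡ m →
      w ⟨$⟩ʳ l ≡ c → w′ ⟨$⟩ʳ l ≡ c →
      (∀ s t → (v ⟨$⟩ʳ s < v ⟨$⟩ʳ t) ⇔ (w ⟨$⟩ʳ f s < w ⟨$⟩ʳ f t)) →
      (∀ s t → (v′ ⟨$⟩ʳ s < v′ ⟨$⟩ʳ t) ⇔ (w′ ⟨$⟩ʳ f s < w′ ⟨$⟩ʳ f t)) →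
      H m v v′ → H n w w′
    general refl c w w′ f f≡ l l≡ wl w′l std std′ vv′ = insertional {m} {1} (∁ ⁅ c ⁆)
      (trans (Subsetₚ.∣∁p∣≡n∸∣p∣ ⁅ c ⁆) (trans (cong (m ℕ.+ 1 ℕ.∸_) (Subsetₚ.∣⁅x⁆∣≡1 c)) (ℕₚ.m+n∸n≡m m 1)))
      (last-insertion c v w (trans (cong (w ⟨$⟩ʳ_) (sym l≗)) wl)
        λ s t → subst₂ (λ i j → (v ⟨$⟩ʳ s < v ⟨$⟩ʳ t) ⇔ (w ⟨$⟩ʳ i < w ⟨$⟩ʳ j)) (f≗ s) (f≗ t) (std s t))
      (last-insertion c v′ w′ (trans (cong (w′ ⟨$⟩ʳ_) (sym l≗)) w′l)
        λ s t → subst₂ (λ i j → (v′ ⟨$⟩ʳ s < v′ ⟨$⟩ʳ t) ⇔ (w′ ⟨$⟩ʳ i < w′ ⟨$⟩ʳ j)) (f≗ s) (f≗ t) (std′ s t))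
      vv′ H-refl
      where
      f≗ : ∀ s → f s ≡ s ↑ˡ 1
      f≗ s = Finₚ.toℕ-injective (trans (f≡ s) (sym (Finₚ.toℕ-↑ˡ s 1)))
      l≗ : l ≡ m ↑ʳ zero
      l≗ = Finₚ.toℕ-injective (trans l≡ (trans (sym (ℕₚ.+-identityʳ m)) (sym (Finₚ.toℕ-↑ʳ m (zero {0})))))

  module _ (γ : Perm k) {j j′ : Fin k} (d : Descent γ j j′)
           (sides : ∀ {a b} → Inverted γ a b → pos γ b Fin.≤ j × j′ Fin.≤ pos γ a)
           {γ′ : Perm k} (γ-edge : Edge γ γ′ (γ ⟨$⟩ʳ j′) (γ ⟨$⟩ʳ j)) (γγ′ : H k γ γ′) where

    private
      top bot : Fin k
      top = γ ⟨$⟩ʳ j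
      bot = γ ⟨$⟩ʳ j′

    -- The occurrence of a scramble expressed through its values. Only the side of the cliff on
    -- which a value lies is recorded, which is all that a scramble shares with `γ`.
    record Occurrence (x : Perm n) (κ : Fin k → Fin n) : Set where
      field
        κ↑       : Increasing κ
        inverted : Inverted x (κ bot) (κ top)
        empty    : ∀ e → pos x (κ top) < pos x e → ¬ (pos x e < pos x (κ bot))
        left     : ∀ v → pos γ v Fin.≤ j → pos x (κ v) Fin.≤ pos x (κ top)
        right    : ∀ v → j′ Fin.≤ pos γ v → pos x (κ bot) Fin.≤ pos x (κ v)

    Contracted : (x : Perm n) (κ : Fin k → Fin n) → Set
    Contracted {n} x κ = ∃ λ x′ → Edge x x′ (κ bot) (κ top) × H n x x′

    -- Now `x` is itself a scramble of `γ`. Rearranging the two increasing sides only adds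
    -- inversions, so `γ ≤ x` and the contraction moves up.
    contract-onto : {x : Perm k} {κ : Fin k → Fin k} → Occurrence x κ → Contracted x κ
    contract-onto {x} {κ} O = x′ , x-edge , edge-up (isCongruence k) {g = γ} {x = x} γ≤x γ-edge
      (edge-transport {x = x} {x′} (κ-id bot) (κ-id top) x-edge) γγ′
      where
      open Occurrence O
      κ-id = increasing-id κ↑
      x′ = proj₁ (uncover x inverted empty)
      x-edge = proj₂ (uncover x inverted empty)

      γ≤x : γ ≤ x
      γ≤x {a} {b} inv@(a<b , _) = a<b , subst₂ _<_ (cong (pos x) (κ-id b)) (cong (pos x) (κ-id a))
        (ℕₚ.≤-<-trans (left b (proj₁ (sides inv))) (ℕₚ.<-≤-trans (proj₂ inverted) (right a (proj₂ (sides inv)))))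

    -- A value c outside the pattern is moved to the front or to the end, on its
    -- side of the cliff, where it can be inserted into a smaller permutation.
    module _ {x : Perm (suc m)} {κ : Fin k → Fin (suc m)} (O : Occurrence x κ)
             (c : Fin (suc m)) (c∉κ : ∀ v → c ≢ κ v) where
      open Occurrence O
      open Equivalence

      private
        sorting = sortBy (λ t → toℕ (pos x (punchIn c t)))
          λ eq → Finₚ.punchIn-injective c _ _ (pos-injective x (Finₚ.toℕ-injective eq))

      deleted : Perm m
      deleted = proj₁ sorting

      deleted-order : ∀ {s t} → pos deleted s < pos deleted t ⇔ pos x (punchIn c s) < pos x (punchIn c t)
      deleted-order = mk⇔ (sorted-cancel
        (λ eq → Finₚ.punchIn-injective c _ _ (pos-injective x (Finₚ.toℕ-injective eq))) deleted (proj₂ sorting))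
        (proj₂ sorting)

      deleted-≤ : ∀ {s t} → pos x (punchIn c s) Fin.≤ pos x (punchIn c t) → pos deleted s Fin.≤ pos deleted t
      deleted-≤ le = ℕₚ.≮⇒≥ λ gt → ℕₚ.<⇒≱ (to deleted-order gt) le

      κ₀ : Fin k → Fin m
      κ₀ v = punchOut (c∉κ v)

      punchIn-κ₀ : ∀ v → punchIn c (κ₀ v) ≡ κ v
      punchIn-κ₀ v = Finₚ.punchIn-punchOut (c∉κ v)

      order₀ : ∀ {v w} → pos x (κ v) < pos x (κ w) → pos deleted (κ₀ v) < pos deleted (κ₀ w)
      order₀ {v} {w} lt = from deleted-order
        (subst₂ (λ a b → pos x a < pos x b) (sym (punchIn-κ₀ v)) (sym (punchIn-κ₀ w)) lt)

      order₀-≤ : ∀ {v w} → pos x (κ v) Fin.≤ pos x (κ w) → pos deleted (κ₀ v) Fin.≤ pos deleted (κ₀ w)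
      order₀-≤ {v} {w} le = deleted-≤
        (subst₂ (λ a b → pos x a Fin.≤ pos x b) (sym (punchIn-κ₀ v)) (sym (punchIn-κ₀ w)) le)

      κ₀↑ : Increasing κ₀
      κ₀↑ {v} {w} v<w = increasing-cancel (punchIn-increasing c)
        (subst₂ _<_ (sym (punchIn-κ₀ v)) (sym (punchIn-κ₀ w)) (κ↑ v<w))

      delete : Occurrence deleted κ₀
      delete = record
        { κ↑ = κ₀↑
        ; inverted = κ₀↑ (proj₂ d) , order₀ (proj₂ inverted)
        ; empty = λ e top<e e<bot → empty (punchIn c e)
            (subst (λ a → pos x a < pos x (punchIn c e)) (punchIn-κ₀ top) (to deleted-order top<e))
            (subst (λ a → pos x (punchIn c e) < pos x a) (punchIn-κ₀ bot) (to deleted-order e<bot))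
        ; left = λ v v≤j → order₀-≤ (left v v≤j)
        ; right = λ v j′≤v → order₀-≤ (right v j′≤v)
        }

      reinsert : (r : Fin (suc m)) →
        (pos x c < pos x (κ top) × (∀ s → r < punchIn r s)) ⊎ (pos x (κ top) < pos x c × (∀ s → punchIn r s < r)) →
        {v′ : Perm m} → Edge deleted v′ (κ₀ bot) (κ₀ top) →
        H (suc m) (insert r c deleted) (insert r c v′) → Contracted x κ
      reinsert r placed {v′} E ww′ = x′ , x-edge , edge-transfer (isCongruence (suc m)) (before x (κ top))
        {w = w} {insert r c v′} {x} {x′} Fw Fx w-edge x-edge ww′
        where
        w = insert r c deleted
        x′ = proj₁ (uncover x inverted empty)
        x-edge = proj₂ (uncover x inverted empty)

        w-edge : Edge w (insert r c v′) (κ bot) (κ top)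
        w-edge = edge-transport {x = w} {insert r c v′} (punchIn-κ₀ bot) (punchIn-κ₀ top)
          (edge-insert r c (Sum.map proj₂ proj₂ placed) {deleted} {v′} E)

        Fx : Follows true (before x (κ top)) (κ bot) (κ top) x
        Fx = before-follows x inverted empty

        c-before? = pos x c Finₚ.<? pos x (κ top)

        -- Among the other values `w` agrees with `x`. As `c` is no end of the arc, a pair with `c`
        -- is admissible only through the label of `c`, and this label chose the end at which `c`
        -- was put.
        follows-at : ∀ {e f} → View r c e → View r c f →
          Admissible true (before x (κ top)) (κ bot) (κ top) e f → pos w f < pos w e
        follows-at self self (_ , e<f , _) = contradiction e<f (ℕₚ.<-irrefl refl)
        follows-at (other s) (other t) adm = to (insert-order r c deleted) (from deleted-order (Fx adm))
        follows-at self (other t) (_ , _ , _ , inj₁ c≡ , _) = contradiction c≡ (c∉κ bot)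
        follows-at self (other t) (_ , _ , _ , inj₂ εc , _) = Sum.[
          (λ (c<top , _) → contradiction c<top (¬does⇒ c-before? εc)) , (λ (_ , last) → last⇒ r c deleted last t) ]′ placed
        follows-at (other s) self (_ , _ , _ , _ , inj₁ c≡) = contradiction c≡ (c∉κ top)
        follows-at (other s) self (_ , _ , _ , _ , inj₂ εc) = Sum.[
          (λ (_ , first) → first⇒ r c deleted first s) ,
          (λ (top<c , _) → contradiction top<c (ℕₚ.<-asym (does⇒ c-before? εc))) ]′ placed

        Fw : Follows true (before x (κ top)) (κ bot) (κ top) w
        Fw {e} {f} = follows-at (view r c e) (view r c f)

      contract-deleted : Contracted deleted κ₀ → Contracted x κ
      contract-deleted (v′ , E , vv′) with pos-connex x (c∉κ top)
      ... | inj₁ c<top = reinsert zero (inj₁ (c<top , λ _ → s≤s z≤n)) {v′} E (insert-first c vv′)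
      ... | inj₂ top<c = reinsert (fromℕ m)
        (inj₂ (top<c , λ s → punchIn-below (fromℕ m) s (subst (toℕ s ℕ.<_) (sym (Finₚ.toℕ-fromℕ m)) (Finₚ.toℕ<n s))))
        {v′} E (insert-last c vv′)

    contract : {x : Perm n} {κ : Fin k → Fin n} → Occurrence x κ → Contracted x κ
    contract {zero} {κ = κ} O with κ top
    ... | ()
    contract {suc m} {x} {κ} O with Finₚ.all? (λ c → Finₚ.any? (λ v → κ v Finₚ.≟ c))
    -- An increasing `κ` that hits every value is bijective, so pigeonhole in both directions
    -- identifies the two sizes.
    ... | yes onto = go (ℕₚ.≤-antisym (Finₚ.injective⇒≤ (increasing-injective (Occurrence.κ↑ O)))
                      (Finₚ.injective⇒≤ {f = proj₁ ∘ onto} λ {c} {c′} eq →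
                        trans (sym (proj₂ (onto c))) (trans (cong κ eq) (proj₂ (onto c′))))) O
      where
      go : ∀ {n} {x : Perm n} {κ : Fin k → Fin n} → k ≡ n → Occurrence x κ → Contracted x κ
      go refl = contract-onto
    ... | no ¬onto with Finₚ.¬∀⟶∃¬ _ _ (λ c → Finₚ.any? (λ v → κ v Finₚ.≟ c)) ¬onto
    ...   | c , c∉ = contract-deleted O c c∉κ (contract (delete O c c∉κ))
      where
      c∉κ : ∀ v → c ≢ κ v
      c∉κ v c≡κv = c∉ (v , sym c≡κv)

theorem9p3 : (C : PermSet) →
    (∀ {k} (γ : Perm k) → C k γ → JoinIrreducible γ × Untranslated γ) →
    (H : Family) → IsSmallestHFamily C H →
    ∀ {n} (x : Perm n) →
    Contracts (H n) x ⇔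
    (∃₂ λ k (γ : Perm k) → C k γ × ∃ λ (σ : Perm k) → Scramble γ σ × OccursWithAdjacentCliff σ x)
theorem9p3 C C⊆ H H-smallest {n} x = mk⇔
  (λ (y , y⋖x , xy) → contracts⇒occurs {x = x} (y , y⋖x , smallest Θ Θ-isHFamily (λ {k} → Θ-contracts {k}) xy))
  occurs⇒contracts
  where
  open IsSmallestHFamily H-smallest
  open ArcCongruence C
  open Contraction C C⊆
  open HFamily isHFamily

  occurs⇒contracts : Occurs x → Contracts (H n) x
  occurs⇒contracts (k , γ , γ∈C , σ , (j , j′ , d , (adj-σ , σj , σj′) , same-left) ,
                    (i , i′ , (_ , σi , σi′) , ι , ι↑ , order , adj)) =
    x′ , edge⇒⋖ x-edge , xx′
    where
    open Cliffs γ (proj₁ (C⊆ γ γ∈C)) (proj₂ (C⊆ γ γ∈C)) d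
    open Equivalence

    -- `Scramble` and `OccursWithAdjacentCliff` each bring a cliff of `σ`; both sit at its largest
    -- and smallest value.
    i≡j : i ≡ j
    i≡j = value-injective σ (Finₚ.toℕ-injective (ℕₚ.suc-injective (trans σi (sym σj))))

    i′≡j′ : i′ ≡ j′
    i′≡j′ = value-injective σ (Finₚ.toℕ-injective (trans σi′ (sym σj′)))

    pos-top : pos σ top ≡ j
    pos-top = trans (cong (pos σ) (Finₚ.toℕ-injective (ℕₚ.suc-injective (trans (proj₁ (proj₂ cliff)) (sym σj))))) (inverseˡ σ)

    pos-bot : pos σ bot ≡ j′
    pos-bot = trans (cong (pos σ) (Finₚ.toℕ-injective (trans (proj₂ (proj₂ cliff)) (sym σj′)))) (inverseˡ σ)

    κ : Fin k → Fin n
    κ v = x ⟨$⟩ʳ ι (pos σ v)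

    pos-κ : ∀ v → pos x (κ v) ≡ ι (pos σ v)
    pos-κ v = inverseˡ x

    κ↑ : Increasing κ
    κ↑ {v} {w} v<w = from (order (pos σ v) (pos σ w)) (subst₂ _<_ (sym (inverseʳ σ)) (sym (inverseʳ σ)) v<w)

    ι-adjacent : Adjacent (pos x (κ top)) (pos x (κ bot))
    ι-adjacent = subst₂ (λ s t → Adjacent s t)
      (sym (trans (pos-κ top) (cong ι (trans pos-top (sym i≡j)))))
      (sym (trans (pos-κ bot) (cong ι (trans pos-bot (sym i′≡j′))))) adj

    κ-≤ : ∀ {v w} → pos σ v Fin.≤ pos σ w → pos x (κ v) Fin.≤ pos x (κ w)
    κ-≤ {v} {w} le = subst₂ Fin._≤_ (sym (pos-κ v)) (sym (pos-κ w)) (increasing-≤ ι↑ le)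

    σ-left : ∀ v → pos γ v < j → pos σ v < j
    σ-left v v<j with from (same-left v) (pos γ v , v<j , inverseʳ γ)
    ... | s , s<j , refl = subst (_< j) (sym (inverseˡ σ)) s<j

    γ-left : ∀ v → pos σ v < j → pos γ v < j
    γ-left v v<j with to (same-left v) (pos σ v , v<j , inverseʳ σ)
    ... | s , s<j , refl = subst (_< j) (sym (inverseˡ γ)) s<j

    left : ∀ v → pos γ v Fin.≤ j → pos σ v Fin.≤ pos σ top
    left v v≤j with ≤⇒<∨≡ v≤j
    ... | inj₁ v<j = subst (pos σ v Fin.≤_) (sym pos-top) (ℕₚ.<⇒≤ (σ-left v v<j))
    ... | inj₂ v≡j = ℕₚ.≤-reflexive (cong (toℕ ∘ pos σ) (trans (sym (inverseʳ γ)) (cong (γ ⟨$⟩ʳ_) v≡j)))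

    -- The scramble condition speaks of the left side only: what is neither there nor at `top` must
    -- lie on the right.
    right : ∀ v → j′ Fin.≤ pos γ v → pos σ bot Fin.≤ pos σ v
    right v j′≤v = subst (Fin._≤ pos σ v) (sym pos-bot)
      (subst (ℕ._≤ toℕ (pos σ v)) (sym adj-σ) (≮∧≢⇒> (λ v<j → ℕₚ.<-asym j<v (γ-left v v<j)) (λ v≡j → Finₚ.<⇒≢ j<v
        (trans (sym (inverseˡ γ)) (cong (pos γ) (pos-injective σ (trans pos-top (sym v≡j))))))))
      where
      j<v : j < pos γ v
      j<v = ℕₚ.<-≤-trans (adjacent⇒< adjacent) j′≤v

    γ-contracted : Contracts (H k) γ
    γ-contracted = contracts γ γ∈C

    contraction = contract γ d inverted⇒sides {proj₁ γ-contracted}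
      (cover-edge (proj₁ (proj₂ γ-contracted))) (proj₂ (proj₂ γ-contracted)) {x = x} {κ} (record
        { κ↑ = κ↑
        ; inverted = κ↑ (proj₂ d) , adjacent⇒< ι-adjacent
        ; empty = λ _ → adjacent⇒empty ι-adjacent
        ; left = λ v v≤j → κ-≤ (left v v≤j)
        ; right = λ v j′≤v → κ-≤ (right v j′≤v)
        })

    x′ = proj₁ contraction
    x-edge = proj₁ (proj₂ contraction)
    xx′ = proj₂ (proj₂ contraction)
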